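{- Let $n\ge2$ and let $M_1,\dots,M_n$ be positive integers with sum $Z$, and put $\mathbf{p}=(M_1/Z,\dots,M_n/Z)$. If $Z$ is prime and $2$ is a primitive root modulo $Z$, then any exact entropy-optimal sampler whose output distribution is $\mathbf{p}$ needs exactly $Z-1$ bits of precision; that is, the minimal precision of an entropy-optimal DDG tree with output distribution exactly $\mathbf{p}$ equals $Z-1$.
   Context: Random bit model: a source supplies independent fair bits. A sampler is described by its discrete distribution generating (DDG) tree $T=(S,r,n,c,\delta)$: $S\subseteq\mathbb{N}$ a set of nodes, $r\in S$ the root, $c:S\to\{1,\dots,n\}\cup\{\mathsf{branch}\}$ labels nodes as branch nodes or leaves labelled by outcomes, $\delta:S\times\{0,1\}\to S$ the transition function. Sampling starts at $r$; at a branch node a fresh fair bit $b$ is drawn and the sampler moves to $\delta(\text{node},b)$; at a leaf labelled $i$ it outputs $i$. $\delta$ may contain back-edges (so a finite $S$ may encode an infinite tree). The output distribution is $(p_1,\dots,p_n)$ with $p_i$ the probability of halting with output $i$. $T$ is entropy-optimal if its expected number of consumed bits is minimal among all DDG trees with the same output distribution. $T$ uses $k$ bits of precision if $S$ is finite and the longest simple path through $\delta$ from $r$ to any leaf has exactly $k$ edges. -}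

module Defs where

open import Data.Nat as ℕ using (ℕ; zero; suc; _^_; _∸_)
open import Data.Nat.DivMod using (_%_)
open import Data.Nat.Coprimality using (Coprime; coprime?)
open import Data.Bool using (Bool; true; false; if_then_else_)
open import Data.Fin using (Fin)
open import Data.Fin.Properties using () renaming (_≟_ to _≟F_)
open import Data.Maybe using (Maybe; just; nothing)
open import Data.List as List using (List; []; _∷_; length)
open import Data.Nat.ListAction using (sum)
open import Data.List.Relation.Unary.Unique.Propositional using (Unique)
open import Data.Product using (Σ; ∃; _×_; ∃-syntax)
open import Data.Integer using (+_)
open import Data.Rational as ℚ using (ℚ; 0ℚ; 1ℚ; ½; _+_; _*_; _-_; _≤_; _<_; ∣_∣)
open import Data.Empty using (⊥)
open import Relation.Nullary using (¬_; does)
open import Relation.Binary.PropositionalEquality using (_≡_)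

totient : ℕ → ℕ
totient m = List.length (List.filter (λ k → coprime? k m) (List.map suc (List.upTo m)))

PrimitiveRoot : ℕ → ℕ → Set
PrimitiveRoot g zero = ⊥
PrimitiveRoot g (suc m) =
  Coprime g (suc m) ×
  ((g ^ totient (suc m)) % suc m ≡ 1 % suc m) ×
  (∀ k → 0 ℕ.< k → k ℕ.< totient (suc m) → ¬ ((g ^ k) % suc m ≡ 1 % suc m))

-- DDG trees
-- Nodes are natural numbers (S ⊆ ℕ; nodes outside the part reachable from
-- the root play no role).  A node is a branch node or a leaf labelled by
-- an outcome in Fin n (outcomes 1..n are Fin n).

data Label (n : ℕ) : Set where
  branch : Label n
  leaf   : Fin n → Label n

record DDG (n : ℕ) : Set where
  field
    root : ℕ
    c    : ℕ → Label n
    δ    : ℕ → Bool → ℕ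
open DDG public

module _ {n : ℕ} (T : DDG n) where

  walk : ℕ → List Bool → Maybe ℕ
  walk v [] = just v
  walk v (b ∷ bs) with c T v
  ... | branch = walk (δ T v b) bs
  ... | leaf _ = nothing

  outFrom : ℕ → List Bool → Maybe (Fin n)
  outFrom v bs with walk v bs
  ... | nothing = nothing
  ... | just u with c T u
  ...   | branch = nothing
  ...   | leaf i = just i

  out : List Bool → Maybe (Fin n)
  out = outFrom (root T)

  visited : ℕ → List Bool → List ℕ
  visited v [] = v ∷ []
  visited v (b ∷ bs) = v ∷ visited (δ T v b) bs

bitstrings : ℕ → List (List Bool)
bitstrings zero = [] ∷ []
bitstrings (suc d) = List.map (true ∷_) (bitstrings d) List.++ List.map (false ∷_) (bitstrings d)

countB : {A : Set} → (A → Bool) → List A → ℕ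
countB p [] = 0
countB p (x ∷ xs) = if p x then suc (countB p xs) else countB p xs

isOut : {n : ℕ} → Fin n → Maybe (Fin n) → Bool
isOut i nothing = false
isOut i (just j) = does (i ≟F j)

isHalt : {n : ℕ} → Maybe (Fin n) → Bool
isHalt nothing = false
isHalt (just _) = true

half^ : ℕ → ℚ
half^ zero = 1ℚ
half^ (suc j) = ½ * half^ j

fromℕ : ℕ → ℚ
fromℕ m = + m ℚ./ 1

sumUpTo : (ℕ → ℚ) → ℕ → ℚ
sumUpTo f zero = f 0
sumUpTo f (suc d) = sumUpTo f d + f (suc d)

probOutAt : {n : ℕ} → DDG n → Fin n → ℕ → ℚ
probOutAt T i j = fromℕ (countB (λ bs → isOut i (out T bs)) (bitstrings j)) * half^ j

probHaltAt : {n : ℕ} → DDG n → ℕ → ℚ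
probHaltAt T j = fromℕ (countB (λ bs → isHalt (out T bs)) (bitstrings j)) * half^ j

Limit : (ℕ → ℚ) → ℚ → Set
Limit s x = ∀ ε → 0ℚ < ε → ∃[ N ] (∀ d → N ℕ.≤ d → ∣ s d - x ∣ ≤ ε)

HasOutput : {n : ℕ} → DDG n → (Fin n → ℚ) → Set
HasOutput T p = ∀ i → Limit (sumUpTo (probOutAt T i)) (p i)

expBitsUpTo : {n : ℕ} → DDG n → ℕ → ℚ
expBitsUpTo T = sumUpTo (λ j → fromℕ j * probHaltAt T j)

-- E[bits of T] ≤ E[bits of T'] as values in [0,∞]
-- (both are suprema of nondecreasing partial sums)
ExpBits≤ : {n : ℕ} → DDG n → DDG n → Set
ExpBits≤ T T' = ∀ d ε → 0ℚ < ε → ∃[ d' ] (expBitsUpTo T d ≤ expBitsUpTo T' d' + ε)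

EntropyOptimal : {n : ℕ} → DDG n → (Fin n → ℚ) → Set
EntropyOptimal T p = HasOutput T p × (∀ T' → HasOutput T' p → ExpBits≤ T T')

FiniteNodes : {n : ℕ} → DDG n → Set
FiniteNodes T = ∃[ m ] (∀ bs v → walk T (root T) bs ≡ just v → v ℕ.< m)

SimplePathToLeaf : {n : ℕ} → DDG n → ℕ → Set
SimplePathToLeaf T k =
  ∃[ bs ] (length bs ≡ k × (∃[ i ] (out T bs ≡ just i)) × Unique (visited T (root T) bs))

UsesPrecision : {n : ℕ} → DDG n → ℕ → Set
UsesPrecision T k =
  FiniteNodes T × SimplePathToLeaf T k × (∀ k' → SimplePathToLeaf T k' → k' ℕ.≤ k)

sumFin : {n : ℕ} → (Fin n → ℕ) → ℕ
sumFin {n} M = sum (List.map M (List.allFin n))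

-- M / Z as a rational (Z = 0 never occurs in the theorem)
ratio : ℕ → ℕ → ℚ
ratio m zero = 0ℚ
ratio m (suc z) = + m ℚ./ suc z

{-# OPTIONS --safe #-}
module Submission where

open import Defs
open import Data.Nat using (ℕ; zero; suc; _+_; _*_; _∸_; _^_; _/_; _%_; _≤_; _<_; z≤n; s≤s; z<s; s<s; NonZero; >-nonZero)
open import Data.Nat.Properties
open import Algebra.Properties.CommutativeSemigroup +-commutativeSemigroup using (interchange)
open import Data.Nat.DivMod
open import Data.Nat.Divisibility using (_∣_; divides; ∣-refl; >⇒∤; ∣m+n∣m⇒∣n; n∣m*n; m%n≡0⇒n∣m)
open import Data.Nat.Primality using (Prime; euclidsLemma; prime⇒nonZero; prime⇒nonTrivial)
open import Data.Nat.Coprimality using (Coprime; coprime?; prime⇒coprime) renaming (sym to coprime-sym)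
open import Data.Nat.ListAction using (sum)
open import Data.Nat.Tactic.RingSolver using (solve-∀)
open import Data.Bool using (Bool; true; false; not; if_then_else_)
open import Data.Fin using (Fin; zero; suc)
open import Data.Fin.Properties using () renaming (_≟_ to _≟F_)
open import Data.Maybe using (Maybe; just; nothing)
import Data.Integer as ℤ
import Data.Integer.Properties as ℤ
open import Data.Rational as ℚ using (ℚ; 0ℚ; 1ℚ; ½; ∣_∣; fromℚᵘ)
import Data.Rational.Properties as ℚ
open import Data.Rational.Unnormalised as ℚᵘ using (mkℚᵘ; *≡*; *≤*)
import Data.Rational.Unnormalised.Properties as ℚᵘ
open import Data.Rational.Solver using (module +-*-Solver)
open +-*-Solver using (solve; con; _:=_; _:+_; _:*_)
import Algebra.Properties.AbelianGroup ℚ.+-0-abelianGroup as ℚ-group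
open import Data.List using (List; []; _∷_; _++_; _∷ʳ_; map; allFin; concatMap; replicate; length; filter; upTo; applyUpTo)
open import Data.List.Properties using (map-tabulate; map-upTo; applyUpTo-∷ʳ; filter-++; filter-all; filter-none; length-applyUpTo; ++-identityʳ)
open import Data.List.Membership.Propositional using (_∈_)
open import Data.List.Membership.Propositional.Properties using (∈-allFin)
open import Data.List.Relation.Unary.Any using (here; there)
open import Data.List.Relation.Unary.All as All using (All; []; _∷_)
open import Data.List.Relation.Unary.All.Properties using (applyUpTo⁺₁)
open import Data.List.Relation.Unary.AllPairs using ([]; _∷_)
open import Data.List.Relation.Unary.Unique.Propositional using (Unique)
open import Data.Product using (∃-syntax; _×_; _,_; proj₁; proj₂)
open import Data.Sum using (_⊎_; inj₁; inj₂)
open import Function using (_∘_; id)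
open import Relation.Nullary using (¬_; yes; no; does; contradiction)
open import Relation.Binary.PropositionalEquality

-- Write pᵢ = Mᵢ / Z and P = Z ∸ 1.  In any tree with output distribution p, the probability of
-- having output i within d bits is a multiple of 2 ^ - d that is at most pᵢ, so at least
-- 2 ^ d - Σᵢ ⌊2 ^ d pᵢ⌋ branch nodes remain at depth d.  As the expected number of bits is the sum
-- over d of (branch nodes at depth d) / 2 ^ d, a tree is optimal iff it attains this bound at every
-- depth, and then its leaves at depth d are labelled by the d-th binary digits of the pᵢ.
-- Since 2 has order P modulo Z, the digits have least period P, and an optimal tree has a single
-- branch node at depth P.  The path to it repeats no node, since a repetition would give the digits
-- a period smaller than P; its last branch node has a leaf as other child, so there is a simple path
-- with P edges to a leaf.  Conversely, identifying the branch node at depth P with the root gives an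
-- optimal tree whose simple paths have at most P edges.

-- Expected numbers of bits are available only as limits of partial sums, so two trees cannot be
-- compared term by term. The comparison runs through E[min(bits, d)], a finite sum of branch counts
-- which, for a tree with output p, has the same supremum as the expected number of bits. One
-- surplus branch node at depth j raises this sum by `2 ^ - j` for good. The explicit tree has at
-- most Z branch nodes at each depth, so its tail beyond depth d is of order `2 ^ - d`, and a deep
-- enough d makes the surplus outweigh the tail and all tolerances. Optimal trees are thus always
-- compared with a concrete tree that attains the bound. In that tree a level is named by
-- `2 ^ d % Z` instead of d, so the tree closes up by itself. This works because Z is odd: the carry
-- when a remainder is doubled modulo Z is the parity of the new remainder, so the leaves of a level
-- depend on the residue alone. The passage from digits to the order of 2 uses that equal digit
-- tails force equal remainders. As the prime Z divides no Mᵢ, the factor Mᵢ cancels, and the digits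
-- of a single outcome already rule out every period below Z ∸ 1.

private
  variable
    A B : Set
    n : ℕ

-- Finite sums, indicators and counting

Σ : List A → (A → ℕ) → ℕ
Σ xs f = sum (map f xs)

Σ-cong : {f g : A → ℕ} → (∀ x → f x ≡ g x) → ∀ xs → Σ xs f ≡ Σ xs g
Σ-cong eq []       = refl
Σ-cong eq (x ∷ xs) = cong₂ _+_ (eq x) (Σ-cong eq xs)

Σ-zero : (f : A → ℕ) → (∀ x → f x ≡ 0) → ∀ xs → Σ xs f ≡ 0
Σ-zero f f≡0 []       = refl
Σ-zero f f≡0 (x ∷ xs) = cong₂ _+_ (f≡0 x) (Σ-zero f f≡0 xs)

Σ-+ : (f g : A → ℕ) → ∀ xs → Σ xs (λ x → f x + g x) ≡ Σ xs f + Σ xs g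
Σ-+ f g []       = refl
Σ-+ f g (x ∷ xs) rewrite Σ-+ f g xs = interchange (f x) (g x) (Σ xs f) (Σ xs g)

Σ-* : ∀ k (f : A → ℕ) xs → Σ xs (λ x → k * f x) ≡ k * Σ xs f
Σ-* k f []       = sym (*-zeroʳ k)
Σ-* k f (x ∷ xs) rewrite Σ-* k f xs = sym (*-distribˡ-+ k (f x) (Σ xs f))

Σ-mono : {f g : A → ℕ} → (∀ x → f x ≤ g x) → ∀ xs → Σ xs f ≤ Σ xs g
Σ-mono le []       = z≤n
Σ-mono le (x ∷ xs) = +-mono-≤ (le x) (Σ-mono le xs)

Σ-∈ : (f : A → ℕ) → ∀ {x xs} → x ∈ xs → f x ≤ Σ xs f
Σ-∈ f {xs = y ∷ xs} (here refl) = m≤m+n (f y) (Σ xs f)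
Σ-∈ f {xs = y ∷ xs} (there x∈)  = ≤-trans (Σ-∈ f x∈) (m≤n+m (Σ xs f) (f y))

Σ-∈₂ : (f : A → ℕ) → ∀ {x y xs} → x ≢ y → x ∈ xs → y ∈ xs → f x + f y ≤ Σ xs f
Σ-∈₂ f x≢y (here refl) (here refl) = contradiction refl x≢y
Σ-∈₂ f {xs = z ∷ _} x≢y (here refl) (there y∈) = +-monoʳ-≤ (f z) (Σ-∈ f y∈)
Σ-∈₂ f {x} {xs = z ∷ _} x≢y (there x∈) (here refl)
  rewrite +-comm (f x) (f z) = +-monoʳ-≤ (f z) (Σ-∈ f x∈)
Σ-∈₂ f {xs = z ∷ _} x≢y (there x∈) (there y∈) =
  ≤-trans (Σ-∈₂ f x≢y x∈ y∈) (m≤n+m _ (f z))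

Σ-tight : {f g : A → ℕ} → (∀ x → f x ≤ g x) → ∀ {xs} → Σ xs g ≤ Σ xs f →
  ∀ {x} → x ∈ xs → f x ≡ g x
Σ-tight {f = f} {g} le {y ∷ xs} Σg≤Σf (here refl) =
  ≤-antisym (le y) (≮⇒≥ λ f<g → <⇒≱ (+-mono-<-≤ f<g (Σ-mono le xs)) Σg≤Σf)
Σ-tight {f = f} {g} le {y ∷ xs} Σg≤Σf (there x∈) =
  Σ-tight le (≮⇒≥ λ f<g → <⇒≱ (+-mono-≤-< (le y) f<g) Σg≤Σf) x∈

sumFin-suc : (f : Fin (suc n) → ℕ) → sumFin f ≡ f zero + sumFin (f ∘ suc)
sumFin-suc {n} f = cong (λ xs → f zero + sum xs)
  (trans (map-tabulate suc f) (sym (map-tabulate id (f ∘ suc))))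

indicator : Bool → ℕ
indicator b = if b then 1 else 0

sumFin-indicator : (k : Fin n) → sumFin (λ i → indicator (does (i ≟F k))) ≡ 1
sumFin-indicator {suc n} zero = trans (sumFin-suc at-zero)
  (cong suc (Σ-zero (at-zero ∘ suc) (λ _ → refl) (allFin n)))
  where
  at-zero : Fin (suc n) → ℕ
  at-zero i = indicator (does (i ≟F zero))
sumFin-indicator {suc n} (suc k) = trans (sumFin-suc at-suc) (sumFin-indicator k)
  where
  at-suc : Fin (suc n) → ℕ
  at-suc i = indicator (does (i ≟F suc k))

countB-cong : {p q : A → Bool} → (∀ x → p x ≡ q x) → ∀ xs → countB p xs ≡ countB q xs
countB-cong eq [] = refl
countB-cong {p = p} {q} eq (x ∷ xs) rewrite eq x with q x
... | true  = cong suc (countB-cong eq xs)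
... | false = countB-cong eq xs

countB-false : (xs : List A) → countB (λ _ → false) xs ≡ 0
countB-false []       = refl
countB-false (_ ∷ xs) = countB-false xs

countB-map : (p : B → Bool) (f : A → B) → ∀ xs → countB p (map f xs) ≡ countB (p ∘ f) xs
countB-map p f [] = refl
countB-map p f (x ∷ xs) with p (f x)
... | true  = cong suc (countB-map p f xs)
... | false = countB-map p f xs

countB-++ : (p : A → Bool) → ∀ xs ys → countB p (xs ++ ys) ≡ countB p xs + countB p ys
countB-++ p [] ys = refl
countB-++ p (x ∷ xs) ys with p x
... | true  = cong suc (countB-++ p xs ys)
... | false = countB-++ p xs ys

-- Labels of the unrolled tree, counted by depth

isBranch : Label n → ℕ
isBranch branch   = 1
isBranch (leaf _) = 0

leafWeight : (Maybe (Fin n) → Bool) → Label n → ℕ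
leafWeight φ branch   = 0
leafWeight φ (leaf i) = indicator (φ (just i))

labelled : Fin n → Label n → ℕ
labelled i = leafWeight (isOut i)

ifBranch : Label n → ℕ → ℕ
ifBranch branch   k = k
ifBranch (leaf _) _ = 0

isBranch≡0 : (l : Label n) → isBranch l ≡ 0 → ∃[ i ] (l ≡ leaf i)
isBranch≡0 (leaf i) _ = i , refl

isBranch≡1 : (l : Label n) → isBranch l ≡ 1 → l ≡ branch
isBranch≡1 branch _ = refl

m+n≡1 : ∀ m n → m + n ≡ 1 → (m ≡ 1 × n ≡ 0) ⊎ (m ≡ 0 × n ≡ 1)
m+n≡1 zero       n eq = inj₂ (refl , eq)
m+n≡1 (suc zero) zero _ = inj₁ (refl , refl)

module _ (T : DDG n) where

  -- cnt f v j is the total f-weight of the labels at depth j of the tree unrolled from v.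
  cnt : (Label n → ℕ) → ℕ → ℕ → ℕ
  cnt f v zero    = f (c T v)
  cnt f v (suc j) = ifBranch (c T v) (cnt f (δ T v true) j + cnt f (δ T v false) j)

  cnt-branch : ∀ f {v} → c T v ≡ branch → ∀ j →
    cnt f v (suc j) ≡ cnt f (δ T v true) j + cnt f (δ T v false) j
  cnt-branch f eq j rewrite eq = refl

  cnt-leaf : ∀ f {v i} → c T v ≡ leaf i → ∀ j → cnt f v (suc j) ≡ 0
  cnt-leaf f eq j rewrite eq = refl

  outFrom-branch : ∀ {v} → c T v ≡ branch → ∀ b bs →
    outFrom T v (b ∷ bs) ≡ outFrom T (δ T v b) bs
  outFrom-branch eq b bs rewrite eq = refl

  outFrom-leaf : ∀ {v i} → c T v ≡ leaf i → ∀ b bs → outFrom T v (b ∷ bs) ≡ nothing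
  outFrom-leaf eq b bs rewrite eq = refl

  outFrom-[] : ∀ {v i} → c T v ≡ leaf i → outFrom T v [] ≡ just i
  outFrom-[] eq rewrite eq = refl

  -- Replaces the enumeration of bit strings in the definition of the output distribution by a
  -- recursion on the tree. Strings that stop at a branch node or run past a leaf give `nothing`,
  -- which `φ` must reject.
  countB-outFrom : ∀ φ → φ nothing ≡ false → ∀ v j →
    countB (φ ∘ outFrom T v) (bitstrings j) ≡ cnt (leafWeight φ) v j
  countB-outFrom φ φ⊥ v zero with c T v
  ... | branch rewrite φ⊥ = refl
  ... | leaf i = refl
  countB-outFrom φ φ⊥ v (suc j) = begin
    countB (φ ∘ outFrom T v) (bitstrings (suc j))
      ≡⟨ countB-++ (φ ∘ outFrom T v) (map (true ∷_) (bitstrings j)) _ ⟩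
    countB (φ ∘ outFrom T v) (map (true ∷_) (bitstrings j)) +
    countB (φ ∘ outFrom T v) (map (false ∷_) (bitstrings j))
      ≡⟨ cong₂ _+_ (countB-map _ (true ∷_) (bitstrings j))
                   (countB-map _ (false ∷_) (bitstrings j)) ⟩
    half true + half false
      ≡⟨ halves (c T v) refl ⟩
    cnt (leafWeight φ) v (suc j) ∎
    where
    open ≡-Reasoning
    half : Bool → ℕ
    half b = countB (λ bs → φ (outFrom T v (b ∷ bs))) (bitstrings j)
    halves : ∀ l → c T v ≡ l → half true + half false ≡ cnt (leafWeight φ) v (suc j)
    halves branch eq = trans (cong₂ _+_ (child true) (child false))
                             (sym (cnt-branch (leafWeight φ) eq j))
      where
      child : ∀ b → half b ≡ cnt (leafWeight φ) (δ T v b) j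
      child b = trans (countB-cong (cong φ ∘ outFrom-branch eq b) (bitstrings j))
                      (countB-outFrom φ φ⊥ (δ T v b) j)
    halves (leaf i) eq = trans (cong₂ _+_ (none true) (none false))
                               (sym (cnt-leaf (leafWeight φ) eq j))
      where
      none : ∀ b → half b ≡ 0
      none b = trans
        (countB-cong (λ bs → trans (cong φ (outFrom-leaf eq b bs)) φ⊥) (bitstrings j))
        (countB-false (bitstrings j))

  cnt-cong : ∀ {f g} → (∀ l → f l ≡ g l) → ∀ v j → cnt f v j ≡ cnt g v j
  cnt-cong eq v zero = eq (c T v)
  cnt-cong eq v (suc j) = cong (ifBranch (c T v))
    (cong₂ _+_ (cnt-cong eq (δ T v true) j) (cnt-cong eq (δ T v false) j))

  cnt-+ : ∀ f g v j → cnt (λ l → f l + g l) v j ≡ cnt f v j + cnt g v j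
  cnt-+ f g v zero = refl
  cnt-+ f g v (suc j) with c T v
  ... | leaf _ = refl
  ... | branch rewrite cnt-+ f g (δ T v true) j | cnt-+ f g (δ T v false) j =
    interchange (cnt f (δ T v true) j) (cnt g (δ T v true) j)
                (cnt f (δ T v false) j) (cnt g (δ T v false) j)

  cnt-0 : ∀ v j → cnt (λ _ → 0) v j ≡ 0
  cnt-0 v zero = refl
  cnt-0 v (suc j) with c T v
  ... | leaf _ = refl
  ... | branch = cong₂ _+_ (cnt-0 (δ T v true) j) (cnt-0 (δ T v false) j)

  cnt-Σ : (f : A → Label n → ℕ) → ∀ xs v j →
    cnt (λ l → Σ xs (λ x → f x l)) v j ≡ Σ xs (λ x → cnt (f x) v j)
  cnt-Σ f [] v j = cnt-0 v j
  cnt-Σ f (x ∷ xs) v j =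
    trans (cnt-+ (f x) _ v j) (cong (cnt (f x) v j +_) (cnt-Σ f xs v j))

  -- The nodes at depth `suc j` are exactly the two children of each branch node at depth `j`.
  cnt-1 : ∀ v j → cnt (λ _ → 1) v (suc j) ≡ 2 * cnt isBranch v j
  cnt-1 v zero with c T v
  ... | branch = refl
  ... | leaf _ = refl
  cnt-1 v (suc j) with c T v
  ... | leaf _ = refl
  ... | branch rewrite cnt-1 (δ T v true) j | cnt-1 (δ T v false) j =
    sym (*-distribˡ-+ 2 (cnt isBranch (δ T v true) j) (cnt isBranch (δ T v false) j))

  alive : ℕ → ℕ
  alive = cnt isBranch (root T)

  halts : ℕ → ℕ
  halts = cnt (leafWeight isHalt) (root T)

  leaves : Fin n → ℕ → ℕ
  leaves i = cnt (labelled i) (root T)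

  halts+alive : ∀ j → halts j + alive j ≡ cnt (λ _ → 1) (root T) j
  halts+alive j = trans (sym (cnt-+ (leafWeight isHalt) isBranch (root T) j))
    (cnt-cong (λ { branch → refl ; (leaf _) → refl }) (root T) j)

  leaves+alive : ∀ j → sumFin (λ i → leaves i j) + alive j ≡ cnt (λ _ → 1) (root T) j
  leaves+alive j = begin
    sumFin (λ i → leaves i j) + alive j
      ≡⟨ cong (_+ alive j) (cnt-Σ labelled (allFin n) (root T) j) ⟨
    cnt (λ l → sumFin (λ i → labelled i l)) (root T) j + alive j
      ≡⟨ cnt-+ _ isBranch (root T) j ⟨
    cnt (λ l → sumFin (λ i → labelled i l) + isBranch l) (root T) j
      ≡⟨ cnt-cong unit (root T) j ⟩
    cnt (λ _ → 1) (root T) j ∎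
    where
    open ≡-Reasoning
    unit : ∀ l → sumFin (λ i → labelled i l) + isBranch l ≡ 1
    unit branch   = cong (_+ 1) (Σ-zero (λ _ → 0) (λ _ → refl) (allFin n))
    unit (leaf k) = cong (_+ 0) (sumFin-indicator k)

  -- cum i d / 2 ^ d is the probability of halting with output i within d bits.
  cum : Fin n → ℕ → ℕ
  cum i zero    = leaves i zero
  cum i (suc d) = 2 * cum i d + leaves i (suc d)

  -- Each of the `2 ^ d` bit strings of length `d` either meets a leaf or ends at a branch node. A
  -- leaf at depth j absorbs `2 ^ (d - j)` of them, which is the repeated doubling in `cum`.
  cum+alive : ∀ d → sumFin (λ i → cum i d) + alive d ≡ 2 ^ d
  cum+alive zero    = leaves+alive zero
  cum+alive (suc d) = begin
    sumFin (λ i → 2 * cum i d + leaves i (suc d)) + alive (suc d)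
      ≡⟨ cong (_+ alive (suc d)) (Σ-+ (λ i → 2 * cum i d) _ (allFin n)) ⟩
    sumFin (λ i → 2 * cum i d) + sumFin (λ i → leaves i (suc d)) + alive (suc d)
      ≡⟨ +-assoc (sumFin (λ i → 2 * cum i d)) _ _ ⟩
    sumFin (λ i → 2 * cum i d) + (sumFin (λ i → leaves i (suc d)) + alive (suc d))
      ≡⟨ cong₂ _+_ (Σ-* 2 (λ i → cum i d) (allFin n))
                   (trans (leaves+alive (suc d)) (cnt-1 (root T) d)) ⟩
    2 * sumFin (λ i → cum i d) + 2 * alive d
      ≡⟨ *-distribˡ-+ 2 (sumFin (λ i → cum i d)) (alive d) ⟨
    2 * (sumFin (λ i → cum i d) + alive d)
      ≡⟨ cong (2 *_) (cum+alive d) ⟩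
    2 ^ suc d ∎
    where open ≡-Reasoning

  -- The shift by `suc k` matters: depth `j` itself may still hold leaves, and only the depths
  -- strictly below are empty.
  dead⇒cnt≡0 : ∀ f v j k → cnt isBranch v j ≡ 0 → cnt f v (j + suc k) ≡ 0
  dead⇒cnt≡0 f v zero k eq with c T v
  ... | leaf _ = refl
  dead⇒cnt≡0 f v (suc j) k eq with c T v
  ... | leaf _ = refl
  ... | branch = cong₂ _+_
    (dead⇒cnt≡0 f (δ T v true) j k (m+n≡0⇒m≡0 _ eq))
    (dead⇒cnt≡0 f (δ T v false) j k (m+n≡0⇒n≡0 (cnt isBranch (δ T v true) j) eq))

  -- A node with a single branch descendant at depth j determines the path leading to it.
  data Spine (v : ℕ) : ℕ → Set where
    stop : c T v ≡ branch → Spine v 0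
    step : ∀ {j} → c T v ≡ branch → ∀ b → cnt isBranch (δ T v (not b)) j ≡ 0 →
           Spine (δ T v b) j → Spine v (suc j)

  spine : ∀ v j → cnt isBranch v j ≡ 1 → Spine v j
  spine v zero    eq = stop (isBranch≡1 (c T v) eq)
  spine v (suc j) eq with c T v in cv
  ... | branch with m+n≡1 (cnt isBranch (δ T v true) j) _ eq
  ...   | inj₁ (t≡1 , f≡0) = step cv true f≡0 (spine (δ T v true) j t≡1)
  ...   | inj₂ (t≡0 , f≡1) = step cv false t≡0 (spine (δ T v false) j f≡1)

  end : ∀ {v j} → Spine v j → ℕ
  end {v} (stop _)     = v
  end (step _ _ _ s)   = end s

  -- Every sibling left behind by the spine is dead, so all nodes strictly deeper than `j` descend
  -- from `end s`.
  cnt-spine : ∀ f {v j} (s : Spine v j) k → cnt f v (j + suc k) ≡ cnt f (end s) (suc k)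
  cnt-spine f (stop _) k = refl
  cnt-spine f {v} {suc j} (step cv true dead s) k = begin
    cnt f v (suc (j + suc k))       ≡⟨ cnt-branch f cv (j + suc k) ⟩
    live + cnt f (δ T v false) (j + suc k)
      ≡⟨ cong (live +_) (dead⇒cnt≡0 f (δ T v false) j k dead) ⟩
    live + 0                        ≡⟨ +-identityʳ live ⟩
    live                            ≡⟨ cnt-spine f s k ⟩
    cnt f (end s) (suc k)           ∎
    where
    open ≡-Reasoning
    live = cnt f (δ T v true) (j + suc k)
  cnt-spine f {v} {suc j} (step cv false dead s) k = begin
    cnt f v (suc (j + suc k))       ≡⟨ cnt-branch f cv (j + suc k) ⟩
    cnt f (δ T v true) (j + suc k) + live
      ≡⟨ cong (_+ live) (dead⇒cnt≡0 f (δ T v true) j k dead) ⟩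
    live                            ≡⟨ cnt-spine f s k ⟩
    cnt f (end s) (suc k)           ∎
    where
    open ≡-Reasoning
    live = cnt f (δ T v false) (j + suc k)

  -- The last bit is flipped: `end s` is a branch node, whereas the sibling at the same depth is
  -- dead at distance 0 and hence a leaf. The path therefore has exactly `j` edges.
  exitBits : ∀ {v j} → Spine v j → List Bool
  exitBits (stop _)                         = []
  exitBits {j = suc zero}    (step _ b _ _) = not b ∷ []
  exitBits {j = suc (suc _)} (step _ b _ s) = b ∷ exitBits s

  length-exitBits : ∀ {v j} (s : Spine v j) → length (exitBits s) ≡ j
  length-exitBits (stop _)                         = refl
  length-exitBits {j = suc zero}    (step _ _ _ _) = refl
  length-exitBits {j = suc (suc _)} (step _ _ _ s) = cong suc (length-exitBits s)

  outFrom-exitBits : ∀ {v j} (s : Spine v (suc j)) → ∃[ i ] (outFrom T v (exitBits s) ≡ just i)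
  outFrom-exitBits {v} {zero} (step cv b dead _) with isBranch≡0 (c T (δ T v (not b))) dead
  ... | i , eq = i , trans (outFrom-branch cv (not b) []) (outFrom-[] eq)
  outFrom-exitBits {v} {suc j} (step cv b _ s) with outFrom-exitBits s
  ... | i , eq = i , trans (outFrom-branch cv b (exitBits s)) eq

  -- A node repeated along the path would make the f-weights below its end periodic.
  module _ (f : Label n → ℕ) (e P : ℕ)
           (aperiodic : ∀ s → 0 < s → s < P → ¬ (∀ k → cnt f e (suc (s + k)) ≡ cnt f e (suc k)))
           where

    Below : ℕ → ℕ → Set
    Below v j = ∀ k → cnt f v (j + suc k) ≡ cnt f e (suc k)

    -- A node lying both `i` and `j` levels above `e` makes the weights below `e` repeat with shift
    -- `j ∸ i`. Since `0 < i` and `j ≤ P`, this shift is less than `P`.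
    ¬Below-twice : ∀ {v i j} → 0 < i → i < j → j ≤ P → Below v i → ¬ Below v j
    ¬Below-twice {v} {i} {j} 0<i i<j j≤P at-i at-j =
      aperiodic (j ∸ i) (m<n⇒0<n∸m i<j) (<-≤-trans (∸-monoʳ-< 0<i (<⇒≤ i<j)) j≤P) λ k → begin
        cnt f e (suc (j ∸ i + k))     ≡⟨ at-i (j ∸ i + k) ⟨
        cnt f v (i + suc (j ∸ i + k)) ≡⟨ cong (cnt f v) (shift k) ⟩
        cnt f v (j + suc k)           ≡⟨ at-j k ⟩
        cnt f e (suc k)               ∎
      where
      open ≡-Reasoning
      shift : ∀ k → i + suc (j ∸ i + k) ≡ j + suc k
      shift k = trans (cong (i +_) (sym (+-suc (j ∸ i) k)))
        (trans (sym (+-assoc i (j ∸ i) (suc k))) (cong (_+ suc k) (m+[n∸m]≡n (<⇒≤ i<j))))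

    Spine⇒Below : ∀ {v j} (s : Spine v j) → end s ≡ e → Below v j
    Spine⇒Below s refl = cnt-spine f s

    branch≢sibling : ∀ {v w b} → c T v ≡ branch → cnt isBranch (δ T w (not b)) 0 ≡ 0 →
      v ≢ δ T w (not b)
    branch≢sibling cv dead refl = 1+n≢0 (trans (cong isBranch (sym cv)) dead)

    -- A spine node equal to `v` would lie at two different heights above `e`, and the final node of
    -- the path differs from `v` because it is a leaf.
    above-fresh : ∀ {v w i j} (s : Spine w (suc j)) → end s ≡ e → suc j < i → i ≤ P →
      c T v ≡ branch → Below v i → All (v ≢_) (visited T w (exitBits s))
    above-fresh {j = zero} s@(step _ b dead _) end≡e j<i i≤P cv at-i =
      (λ { refl → ¬Below-twice z<s j<i i≤P (Spine⇒Below s end≡e) at-i })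
      ∷ branch≢sibling {b = b} cv dead ∷ []
    above-fresh {j = suc j} s@(step _ _ _ s′) end≡e j<i i≤P cv at-i =
      (λ { refl → ¬Below-twice z<s j<i i≤P (Spine⇒Below s end≡e) at-i })
      ∷ above-fresh s′ end≡e (<-trans (n<1+n _) j<i) i≤P cv at-i

    exitBits-simple : ∀ {v j} (s : Spine v (suc j)) → end s ≡ e → suc j ≤ P →
      Unique (visited T v (exitBits s))
    exitBits-simple {v} {zero} (step cv b dead _) _ _ =
      (branch≢sibling {b = b} cv dead ∷ []) ∷ [] ∷ []
    exitBits-simple {v} {suc j} s@(step cv b _ s′) end≡e j≤P =
      above-fresh s′ end≡e (n<1+n _) j≤P cv (Spine⇒Below s end≡e)
      ∷ exitBits-simple s′ end≡e (≤-trans (n≤1+n _) j≤P)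

  -- Aperiodicity is stated at the root with offset `P`, so that it does not mention the end of the
  -- spine; `cnt-spine` moves it there.
  simplePathToLeaf : ∀ f P → 0 < P → alive P ≡ 1 →
    (∀ s → 0 < s → s < P →
      ¬ (∀ k → cnt f (root T) (P + suc (s + k)) ≡ cnt f (root T) (P + suc k))) →
    SimplePathToLeaf T P
  simplePathToLeaf f (suc P) _ alive≡1 aperiodic =
    exitBits s , length-exitBits s , outFrom-exitBits s ,
    exitBits-simple f (end s) (suc P)
      (λ t 0<t t<P per → aperiodic t 0<t t<P λ k →
        trans (cnt-spine f s (t + k)) (trans (per k) (sym (cnt-spine f s k))))
      s refl ≤-refl
    where s = spine (root T) (suc P) alive≡1

-- Dyadic rationals and limits

fromℚᵘ-+ : ∀ p q → fromℚᵘ (p ℚᵘ.+ q) ≡ fromℚᵘ p ℚ.+ fromℚᵘ q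
fromℚᵘ-+ p q = ℚ.toℚᵘ-injective (ℚᵘ.≃-trans (ℚ.toℚᵘ-fromℚᵘ (p ℚᵘ.+ q)) (ℚᵘ.≃-sym
  (ℚᵘ.≃-trans (ℚ.toℚᵘ-homo-+ (fromℚᵘ p) (fromℚᵘ q))
    (ℚᵘ.+-cong (ℚ.toℚᵘ-fromℚᵘ p) (ℚ.toℚᵘ-fromℚᵘ q)))))

fromℚᵘ-* : ∀ p q → fromℚᵘ (p ℚᵘ.* q) ≡ fromℚᵘ p ℚ.* fromℚᵘ q
fromℚᵘ-* p q = ℚ.toℚᵘ-injective (ℚᵘ.≃-trans (ℚ.toℚᵘ-fromℚᵘ (p ℚᵘ.* q)) (ℚᵘ.≃-sym
  (ℚᵘ.≃-trans (ℚ.toℚᵘ-homo-* (fromℚᵘ p) (fromℚᵘ q))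
    (ℚᵘ.*-cong (ℚ.toℚᵘ-fromℚᵘ p) (ℚ.toℚᵘ-fromℚᵘ q)))))

fromℕ-+ : ∀ a b → fromℕ (a + b) ≡ fromℕ a ℚ.+ fromℕ b
fromℕ-+ a b = trans
  (ℚ.fromℚᵘ-cong {mkℚᵘ (ℤ.+ (a + b)) 0} {mkℚᵘ (ℤ.+ a) 0 ℚᵘ.+ mkℚᵘ (ℤ.+ b) 0}
    (*≡* (cong (ℤ._* ℤ.+ 1) (sym (cong₂ ℤ._+_ (ℤ.*-identityʳ (ℤ.+ a)) (ℤ.*-identityʳ (ℤ.+ b)))))))
  (fromℚᵘ-+ (mkℚᵘ (ℤ.+ a) 0) (mkℚᵘ (ℤ.+ b) 0))

fromℕ-* : ∀ a b → fromℕ (a * b) ≡ fromℕ a ℚ.* fromℕ b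
fromℕ-* a b = trans
  (ℚ.fromℚᵘ-cong {mkℚᵘ (ℤ.+ (a * b)) 0} {mkℚᵘ (ℤ.+ a) 0 ℚᵘ.* mkℚᵘ (ℤ.+ b) 0}
    (*≡* (cong (ℤ._* ℤ.+ 1) (ℤ.pos-* a b))))
  (fromℚᵘ-* (mkℚᵘ (ℤ.+ a) 0) (mkℚᵘ (ℤ.+ b) 0))

fromℕ-mono : ∀ a b → a ≤ b → fromℕ a ℚ.≤ fromℕ b
fromℕ-mono a b a≤b = ℚ.toℚᵘ-cancel-≤
  (ℚᵘ.≤-respˡ-≃ (ℚᵘ.≃-sym (ℚ.toℚᵘ-fromℚᵘ (mkℚᵘ (ℤ.+ a) 0)))
    (ℚᵘ.≤-respʳ-≃ (ℚᵘ.≃-sym (ℚ.toℚᵘ-fromℚᵘ (mkℚᵘ (ℤ.+ b) 0)))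
      (*≤* (ℤ.*-monoʳ-≤-nonNeg (ℤ.+ 1) (ℤ.+≤+ a≤b)))))

fromℕ-cancel-≤ : ∀ a b → fromℕ a ℚ.≤ fromℕ b → a ≤ b
fromℕ-cancel-≤ a b le
  with ℚᵘ.≤-respˡ-≃ (ℚ.toℚᵘ-fromℚᵘ (mkℚᵘ (ℤ.+ a) 0))
         (ℚᵘ.≤-respʳ-≃ (ℚ.toℚᵘ-fromℚᵘ (mkℚᵘ (ℤ.+ b) 0)) (ℚ.toℚᵘ-mono-≤ le))
... | *≤* le′ = ℤ.drop‿+≤+ (ℤ.*-cancelʳ-≤-pos (ℤ.+ a) (ℤ.+ b) (ℤ.+ 1) le′)

ratio-*-fromℕ : ∀ m Z .{{_ : NonZero Z}} → ratio m Z ℚ.* fromℕ Z ≡ fromℕ m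
ratio-*-fromℕ m Z@(suc z) = trans (sym (fromℚᵘ-* (mkℚᵘ (ℤ.+ m) z) (mkℚᵘ (ℤ.+ Z) 0)))
  (ℚ.fromℚᵘ-cong {mkℚᵘ (ℤ.+ m) z ℚᵘ.* mkℚᵘ (ℤ.+ Z) 0} {mkℚᵘ (ℤ.+ m) 0}
    (*≡* (trans (ℤ.*-identityʳ _) (cong (ℤ.+ m ℤ.*_) (cong (ℤ.+_ ∘ suc) (sym (*-identityʳ z)))))))

fromℕ-nonNeg : ∀ a → ℚ.NonNegative (fromℕ a)
fromℕ-nonNeg a = ℚ.normalize-nonNeg a 1

fromℕ-pos : ∀ a .{{_ : NonZero a}} → ℚ.Positive (fromℕ a)
fromℕ-pos a@(suc _) = ℚ.positive (ℚ.<-≤-trans (ℚ.positive⁻¹ 1ℚ) (fromℕ-mono 1 a (s≤s z≤n)))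

half^-pos : ∀ d → ℚ.Positive (half^ d)
half^-pos zero    = _
half^-pos (suc d) = ℚ.positive
  (subst (ℚ._< ½ ℚ.* half^ d) (ℚ.*-zeroʳ ½)
    (ℚ.*-monoʳ-<-pos ½ (ℚ.positive⁻¹ (half^ d) {{half^-pos d}})))

half^-nonNeg : ∀ d → ℚ.NonNegative (half^ d)
half^-nonNeg d = ℚ.pos⇒nonNeg (half^ d) {{half^-pos d}}

½*h*2t : ∀ h t → ½ ℚ.* h ℚ.* (fromℕ 2 ℚ.* t) ≡ h ℚ.* t
½*h*2t h t = begin
  ½ ℚ.* h ℚ.* (fromℕ 2 ℚ.* t)    ≡⟨ solve 4 (λ a h b t → a :* h :* (b :* t) := a :* b :* (h :* t)) refl ½ h (fromℕ 2) t ⟩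
  1ℚ ℚ.* (h ℚ.* t)               ≡⟨ ℚ.*-identityˡ (h ℚ.* t) ⟩
  h ℚ.* t                        ∎
  where open ≡-Reasoning

half^-2^ : ∀ d → half^ d ℚ.* fromℕ (2 ^ d) ≡ 1ℚ
half^-2^ zero    = refl
half^-2^ (suc d) = begin
  ½ ℚ.* half^ d ℚ.* fromℕ (2 * 2 ^ d)              ≡⟨ cong (½ ℚ.* half^ d ℚ.*_) (fromℕ-* 2 (2 ^ d)) ⟩
  ½ ℚ.* half^ d ℚ.* (fromℕ 2 ℚ.* fromℕ (2 ^ d))    ≡⟨ ½*h*2t (half^ d) (fromℕ (2 ^ d)) ⟩
  half^ d ℚ.* fromℕ (2 ^ d)                        ≡⟨ half^-2^ d ⟩
  1ℚ                                               ∎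
  where open ≡-Reasoning

half^-+ : ∀ a b → half^ (a + b) ≡ half^ a ℚ.* half^ b
half^-+ zero    b = sym (ℚ.*-identityˡ (half^ b))
half^-+ (suc a) b = trans (cong (½ ℚ.*_) (half^-+ a b)) (sym (ℚ.*-assoc ½ (half^ a) (half^ b)))

*-monoˡ : ∀ {p q} r → ℚ.NonNegative r → p ℚ.≤ q → p ℚ.* r ℚ.≤ q ℚ.* r
*-monoˡ r r≥0 = ℚ.*-monoʳ-≤-nonNeg r {{r≥0}}

p≤p+nonNeg : ∀ p {q} → 0ℚ ℚ.≤ q → p ℚ.≤ p ℚ.+ q
p≤p+nonNeg p {q} 0≤q = subst (ℚ._≤ p ℚ.+ q) (ℚ.+-identityʳ p) (ℚ.+-monoʳ-≤ p 0≤q)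

*-nonNeg : ∀ p q → ℚ.NonNegative p → ℚ.NonNegative q → 0ℚ ℚ.≤ p ℚ.* q
*-nonNeg p q p≥0 q≥0 =
  ℚ.nonNegative⁻¹ (p ℚ.* q) {{ℚ.nonNeg*nonNeg⇒nonNeg p {{p≥0}} q {{q≥0}}}}

dyadic≥0 : ∀ a d → 0ℚ ℚ.≤ fromℕ a ℚ.* half^ d
dyadic≥0 a d = *-nonNeg (fromℕ a) (half^ d) (fromℕ-nonNeg a) (half^-nonNeg d)

dyadic-mono : ∀ {a b} d → a ≤ b → fromℕ a ℚ.* half^ d ℚ.≤ fromℕ b ℚ.* half^ d
dyadic-mono {a} {b} d a≤b = *-monoˡ (half^ d) (half^-nonNeg d) (fromℕ-mono a b a≤b)

half^-antitone : ∀ d k → half^ (d + k) ℚ.≤ half^ d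
half^-antitone d k = begin
  half^ (d + k)            ≡⟨ half^-+ d k ⟩
  half^ d ℚ.* half^ k      ≤⟨ ℚ.*-monoˡ-≤-nonNeg (half^ d) {{half^-nonNeg d}} (half^≤1 k) ⟩
  half^ d ℚ.* 1ℚ           ≡⟨ ℚ.*-identityʳ (half^ d) ⟩
  half^ d                  ∎
  where
  open ℚ.≤-Reasoning
  half^≤1 : ∀ k → half^ k ℚ.≤ 1ℚ
  half^≤1 k = begin
    half^ k                      ≡⟨ ℚ.*-identityʳ (half^ k) ⟨
    half^ k ℚ.* fromℕ 1          ≤⟨ ℚ.*-monoˡ-≤-nonNeg (half^ k) {{half^-nonNeg k}} (fromℕ-mono 1 (2 ^ k) (m^n>0 2 k)) ⟩
    half^ k ℚ.* fromℕ (2 ^ k)    ≡⟨ half^-2^ k ⟩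
    1ℚ                           ∎

n<2^n : ∀ k → k < 2 ^ k
n<2^n zero    = z<s
n<2^n (suc k) = begin-strict
  suc k           ≤⟨ n<2^n k ⟩
  2 ^ k           <⟨ m<m+n (2 ^ k) (m^n>0 2 k) ⟩
  2 ^ k + 2 ^ k   ≡⟨ cong (2 ^ k +_) (+-identityʳ (2 ^ k)) ⟨
  2 ^ suc k       ∎
  where open ≤-Reasoning

fromℕ-half^ : ∀ k → fromℕ k ℚ.* half^ k ℚ.≤ 1ℚ
fromℕ-half^ k = begin
  fromℕ k ℚ.* half^ k          ≤⟨ dyadic-mono k (<⇒≤ (n<2^n k)) ⟩
  fromℕ (2 ^ k) ℚ.* half^ k    ≡⟨ ℚ.*-comm (fromℕ (2 ^ k)) (half^ k) ⟩
  half^ k ℚ.* fromℕ (2 ^ k)    ≡⟨ half^-2^ k ⟩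
  1ℚ                           ∎
  where open ℚ.≤-Reasoning

-- The denominator q of `ε` serves as exponent: `1 ≤ q * ε` because the numerator is at least 1, and
-- `q * half^ q ≤ 1`.
half^-small : ∀ {ε} → 0ℚ ℚ.< ε → ∃[ k ] (half^ k ℚ.≤ ε)
half^-small {ε} 0<ε = q , (begin
  half^ q                                ≡⟨ ℚ.*-identityʳ (half^ q) ⟨
  half^ q ℚ.* 1ℚ                         ≤⟨ ℚ.*-monoˡ-≤-nonNeg (half^ q) {{half^-nonNeg q}} (1≤qε ε 0<ε) ⟩
  half^ q ℚ.* (fromℕ q ℚ.* ε)            ≡⟨ solve 3 (λ h a e → h :* (a :* e) := (a :* h) :* e) refl (half^ q) (fromℕ q) ε ⟩
  (fromℕ q ℚ.* half^ q) ℚ.* ε            ≤⟨ *-monoˡ ε ε≥0 (fromℕ-half^ q) ⟩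
  1ℚ ℚ.* ε                               ≡⟨ ℚ.*-identityˡ ε ⟩
  ε                                      ∎)
  where
  open ℚ.≤-Reasoning
  q = ℚ.denominatorℕ ε
  ε≥0 = ℚ.nonNegative (ℚ.<⇒≤ 0<ε)
  1≤qε : ∀ ε → 0ℚ ℚ.< ε → 1ℚ ℚ.≤ fromℕ (ℚ.denominatorℕ ε) ℚ.* ε
  1≤qε ε@(ℚ.mkℚ (ℤ.+ suc a) b _) 0<ε = begin
    fromℕ 1             ≤⟨ fromℕ-mono 1 (suc a) (s≤s z≤n) ⟩
    fromℕ (suc a)       ≡⟨ ratio-*-fromℕ (suc a) (suc b) ⟨
    ratio (suc a) (suc b) ℚ.* fromℕ (suc b) ≡⟨ cong (ℚ._* fromℕ (suc b)) (ℚ.↥p/↧p≡p ε) ⟩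
    ε ℚ.* fromℕ (suc b) ≡⟨ ℚ.*-comm ε (fromℕ (suc b)) ⟩
    fromℕ (suc b) ℚ.* ε ∎
  1≤qε ε@(ℚ.mkℚ (ℤ.+ zero) b _) 0<ε with ℚ.positive 0<ε
  ... | ()
  1≤qε ε@(ℚ.mkℚ (ℤ.-[1+ _ ]) b _) 0<ε with ℚ.positive 0<ε
  ... | ()

p≤∣p∣ : ∀ p → p ℚ.≤ ∣ p ∣
p≤∣p∣ p with ℚ.≤-total 0ℚ p
... | inj₁ 0≤p = ℚ.≤-reflexive (sym (ℚ.0≤p⇒∣p∣≡p 0≤p))
... | inj₂ p≤0 = ℚ.≤-trans p≤0 (ℚ.0≤∣p∣ p)

b+[a-b]≡a : ∀ b a → b ℚ.+ (a ℚ.- b) ≡ a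
b+[a-b]≡a b a = trans (ℚ.+-comm b (a ℚ.- b)) (ℚ-group.//-rightDividesˡ b a)

∣a-b∣≤e⇒a≤b+e : ∀ a b {e} → ∣ a ℚ.- b ∣ ℚ.≤ e → a ℚ.≤ b ℚ.+ e
∣a-b∣≤e⇒a≤b+e a b {e} le = begin
  a                     ≡⟨ b+[a-b]≡a b a ⟨
  b ℚ.+ (a ℚ.- b)       ≤⟨ ℚ.+-monoʳ-≤ b (ℚ.≤-trans (p≤∣p∣ (a ℚ.- b)) le) ⟩
  b ℚ.+ e               ∎
  where open ℚ.≤-Reasoning

∣-∣-swap : ∀ a b → ∣ a ℚ.- b ∣ ≡ ∣ b ℚ.- a ∣
∣-∣-swap a b = trans (sym (ℚ.∣-p∣≡∣p∣ (a ℚ.- b)))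
  (cong ∣_∣ (ℚ-group.⁻¹-anti-homo‿- a b))

a≤b≤a+e⇒∣a-b∣≤e : ∀ {a b e} → a ℚ.≤ b → b ℚ.≤ a ℚ.+ e → ∣ a ℚ.- b ∣ ℚ.≤ e
a≤b≤a+e⇒∣a-b∣≤e {a} {b} {e} a≤b b≤a+e = begin
  ∣ a ℚ.- b ∣          ≡⟨ ∣-∣-swap a b ⟩
  ∣ b ℚ.- a ∣          ≡⟨ ℚ.0≤p⇒∣p∣≡p (subst (ℚ._≤ b ℚ.- a) (ℚ.+-inverseʳ a) (ℚ.+-monoˡ-≤ (ℚ.- a) a≤b)) ⟩
  b ℚ.- a              ≤⟨ ℚ.+-monoˡ-≤ (ℚ.- a) b≤a+e ⟩
  a ℚ.+ e ℚ.- a        ≡⟨ ℚ-group.xyx⁻¹≈y a e ⟩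
  e                    ∎
  where open ℚ.≤-Reasoning

≤+ε⇒≤ : ∀ {a b} → (∀ ε → 0ℚ ℚ.< ε → a ℚ.≤ b ℚ.+ ε) → a ℚ.≤ b
≤+ε⇒≤ {a} {b} h with a ℚ.≤? b
... | yes a≤b = a≤b
... | no  a≰b with ℚ.<-dense (ℚ.≰⇒> a≰b)
...   | m , b<m , m<a = contradiction (ℚ.≤-<-trans (h (m ℚ.- b) 0<m-b) b+[m-b]<a) (ℚ.<-irrefl refl)
  where
  0<m-b : 0ℚ ℚ.< m ℚ.- b
  0<m-b = subst (ℚ._< m ℚ.- b) (ℚ.+-inverseʳ b) (ℚ.+-monoˡ-< (ℚ.- b) b<m)
  b+[m-b]<a : b ℚ.+ (m ℚ.- b) ℚ.< a
  b+[m-b]<a = subst (ℚ._< a) (sym (b+[a-b]≡a b m)) m<a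

Limit-lower-bound : ∀ {s x} → (∀ d k → s d ℚ.≤ s (d + k)) → Limit s x → ∀ d → s d ℚ.≤ x
Limit-lower-bound {s} {x} mono lim d = ≤+ε⇒≤ λ ε 0<ε →
  let N , close = lim ε 0<ε in
  ℚ.≤-trans (mono d N) (∣a-b∣≤e⇒a≤b+e (s (d + N)) x (close (d + N) (m≤n+m N d)))

half^-close⇒Limit : ∀ {s x} → (∀ d → ∣ s d ℚ.- x ∣ ℚ.≤ half^ d) → Limit s x
half^-close⇒Limit {s} {x} close ε 0<ε = k , λ d k≤d → begin
  ∣ s d ℚ.- x ∣       ≤⟨ close d ⟩
  half^ d             ≡⟨ cong half^ (m+[n∸m]≡n k≤d) ⟨
  half^ (k + (d ∸ k)) ≤⟨ half^-antitone k (d ∸ k) ⟩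
  half^ k             ≤⟨ proj₂ (half^-small 0<ε) ⟩
  ε                   ∎
  where
  open ℚ.≤-Reasoning
  k = proj₁ (half^-small 0<ε)

-- Used in two ways: to collect the mass of the children of a level, and with `b = 0` to rewrite a
-- count at one depth as twice that count one level deeper.
half^-merge : ∀ a b m h → a + b ≡ 2 * m →
  fromℕ a ℚ.* (½ ℚ.* h) ℚ.+ fromℕ b ℚ.* (½ ℚ.* h) ≡ fromℕ m ℚ.* h
half^-merge a b m h eq = begin
  fromℕ a ℚ.* (½ ℚ.* h) ℚ.+ fromℕ b ℚ.* (½ ℚ.* h) ≡⟨ ℚ.*-distribʳ-+ (½ ℚ.* h) (fromℕ a) (fromℕ b) ⟨
  (fromℕ a ℚ.+ fromℕ b) ℚ.* (½ ℚ.* h)             ≡⟨ cong (ℚ._* (½ ℚ.* h)) (trans (sym (fromℕ-+ a b)) (trans (cong fromℕ eq) (fromℕ-* 2 m))) ⟩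
  fromℕ 2 ℚ.* fromℕ m ℚ.* (½ ℚ.* h)               ≡⟨ trans (ℚ.*-comm (fromℕ 2 ℚ.* fromℕ m) (½ ℚ.* h)) (trans (½*h*2t h (fromℕ m)) (ℚ.*-comm h (fromℕ m))) ⟩
  fromℕ m ℚ.* h                                   ∎
  where open ≡-Reasoning

module _ (Z : ℕ) .{{_ : NonZero Z}} (m d : ℕ) where

  private
    -- Multiplication by `Z * 2 ^ d` clears the denominators of both a dyadic number and
    -- `ratio m Z`, so their order becomes an order of natural numbers.
    scale : ℚ
    scale = fromℕ Z ℚ.* fromℕ (2 ^ d)

    scale-pos : ℚ.Positive scale
    scale-pos = subst ℚ.Positive (fromℕ-* Z (2 ^ d))
      (fromℕ-pos (Z * 2 ^ d))
      where instance
        2^d≢0 : NonZero (2 ^ d)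
        2^d≢0 = m^n≢0 2 d
        Z*2^d≢0 : NonZero (Z * 2 ^ d)
        Z*2^d≢0 = m*n≢0 Z (2 ^ d)

    dyadic-scale : ∀ a → fromℕ a ℚ.* half^ d ℚ.* scale ≡ fromℕ (Z * a)
    dyadic-scale a = begin
      fromℕ a ℚ.* half^ d ℚ.* scale
        ≡⟨ solve 4 (λ a h z t → a :* h :* (z :* t) := z :* a :* (h :* t)) refl (fromℕ a) (half^ d) (fromℕ Z) (fromℕ (2 ^ d)) ⟩
      fromℕ Z ℚ.* fromℕ a ℚ.* (half^ d ℚ.* fromℕ (2 ^ d))
        ≡⟨ cong (fromℕ Z ℚ.* fromℕ a ℚ.*_) (half^-2^ d) ⟩
      fromℕ Z ℚ.* fromℕ a ℚ.* 1ℚ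
        ≡⟨ ℚ.*-identityʳ _ ⟩
      fromℕ Z ℚ.* fromℕ a
        ≡⟨ fromℕ-* Z a ⟨
      fromℕ (Z * a) ∎
      where open ≡-Reasoning

    ratio-scale : ratio m Z ℚ.* scale ≡ fromℕ (2 ^ d * m)
    ratio-scale = begin
      ratio m Z ℚ.* scale                         ≡⟨ ℚ.*-assoc (ratio m Z) (fromℕ Z) (fromℕ (2 ^ d)) ⟨
      ratio m Z ℚ.* fromℕ Z ℚ.* fromℕ (2 ^ d)     ≡⟨ cong (ℚ._* fromℕ (2 ^ d)) (ratio-*-fromℕ m Z) ⟩
      fromℕ m ℚ.* fromℕ (2 ^ d)                   ≡⟨ ℚ.*-comm (fromℕ m) (fromℕ (2 ^ d)) ⟩
      fromℕ (2 ^ d) ℚ.* fromℕ m                   ≡⟨ fromℕ-* (2 ^ d) m ⟨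
      fromℕ (2 ^ d * m)                           ∎
      where open ≡-Reasoning

  dyadic≤ratio⇒ : ∀ a → fromℕ a ℚ.* half^ d ℚ.≤ ratio m Z → Z * a ≤ 2 ^ d * m
  dyadic≤ratio⇒ a le = fromℕ-cancel-≤ (Z * a) (2 ^ d * m) (subst₂ ℚ._≤_ (dyadic-scale a) ratio-scale
    (*-monoˡ scale (ℚ.pos⇒nonNeg scale {{scale-pos}}) le))

  dyadic≤ratio : ∀ a → Z * a ≤ 2 ^ d * m → fromℕ a ℚ.* half^ d ℚ.≤ ratio m Z
  dyadic≤ratio a le = ℚ.*-cancelʳ-≤-pos scale {{scale-pos}}
    (subst₂ ℚ._≤_ (sym (dyadic-scale a)) (sym ratio-scale) (fromℕ-mono (Z * a) (2 ^ d * m) le))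

  ratio≤dyadic : ∀ a → 2 ^ d * m ≤ Z * a → ratio m Z ℚ.≤ fromℕ a ℚ.* half^ d
  ratio≤dyadic a le = ℚ.*-cancelʳ-≤-pos scale {{scale-pos}}
    (subst₂ ℚ._≤_ (sym ratio-scale) (sym (dyadic-scale a)) (fromℕ-mono (2 ^ d * m) (Z * a) le))

ratio-+ : ∀ a b Z .{{_ : NonZero Z}} → ratio (a + b) Z ≡ ratio a Z ℚ.+ ratio b Z
ratio-+ a b Z = ℚ.≤-antisym (ℚ.*-cancelʳ-≤-pos (fromℕ Z) {{fromℕ-pos Z}} (ℚ.≤-reflexive eq))
                            (ℚ.*-cancelʳ-≤-pos (fromℕ Z) {{fromℕ-pos Z}} (ℚ.≤-reflexive (sym eq)))
  where
  open ≡-Reasoning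
  eq : ratio (a + b) Z ℚ.* fromℕ Z ≡ (ratio a Z ℚ.+ ratio b Z) ℚ.* fromℕ Z
  eq = begin
    ratio (a + b) Z ℚ.* fromℕ Z                           ≡⟨ ratio-*-fromℕ (a + b) Z ⟩
    fromℕ (a + b)                                         ≡⟨ fromℕ-+ a b ⟩
    fromℕ a ℚ.+ fromℕ b                                   ≡⟨ cong₂ ℚ._+_ (ratio-*-fromℕ a Z) (ratio-*-fromℕ b Z) ⟨
    ratio a Z ℚ.* fromℕ Z ℚ.+ ratio b Z ℚ.* fromℕ Z       ≡⟨ ℚ.*-distribʳ-+ (fromℕ Z) (ratio a Z) (ratio b Z) ⟨
    (ratio a Z ℚ.+ ratio b Z) ℚ.* fromℕ Z                 ∎

ℚ-cancelˡ : ∀ r {p q} → r ℚ.+ p ℚ.≤ r ℚ.+ q → p ℚ.≤ q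
ℚ-cancelˡ r {p} {q} le = subst₂ ℚ._≤_ (cancel p) (cancel q) (ℚ.+-monoʳ-≤ (ℚ.- r) le)
  where
  cancel : ∀ p → ℚ.- r ℚ.+ (r ℚ.+ p) ≡ p
  cancel = ℚ-group.\\-leftDividesʳ r

-- Expected number of bits

sumUpTo-mono : ∀ {f} → (∀ j → 0ℚ ℚ.≤ f j) → ∀ d k → sumUpTo f d ℚ.≤ sumUpTo f (d + k)
sumUpTo-mono {f} f≥0 d zero rewrite +-identityʳ d = ℚ.≤-refl
sumUpTo-mono {f} f≥0 d (suc k) rewrite +-suc d k =
  ℚ.≤-trans (sumUpTo-mono f≥0 d k) (p≤p+nonNeg (sumUpTo f (d + k)) (f≥0 (suc (d + k))))

module _ (T : DDG n) where

  aliveProb : ℕ → ℚ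
  aliveProb d = fromℕ (alive T d) ℚ.* half^ d

  aliveProb≥0 : ∀ d → 0ℚ ℚ.≤ aliveProb d
  aliveProb≥0 d = dyadic≥0 (alive T d) d

  probOutAt≡ : ∀ i j → probOutAt T i j ≡ fromℕ (leaves T i j) ℚ.* half^ j
  probOutAt≡ i j = cong (λ k → fromℕ k ℚ.* half^ j) (countB-outFrom T (isOut i) refl (root T) j)

  probHaltAt≡ : ∀ j → probHaltAt T j ≡ fromℕ (halts T j) ℚ.* half^ j
  probHaltAt≡ j = cong (λ k → fromℕ k ℚ.* half^ j) (countB-outFrom T isHalt refl (root T) j)

  probHaltAt≥0 : ∀ j → 0ℚ ℚ.≤ probHaltAt T j
  probHaltAt≥0 j = subst (0ℚ ℚ.≤_) (sym (probHaltAt≡ j))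
    (dyadic≥0 (halts T j) j)

  probHaltAt+aliveProb : ∀ d → probHaltAt T (suc d) ℚ.+ aliveProb (suc d) ≡ aliveProb d
  probHaltAt+aliveProb d = trans (cong (ℚ._+ aliveProb (suc d)) (probHaltAt≡ (suc d)))
    (half^-merge (halts T (suc d)) (alive T (suc d)) (alive T d) (half^ d)
      (trans (halts+alive T (suc d)) (cnt-1 T (root T) d)))

  cum-prob : ∀ i d → sumUpTo (probOutAt T i) d ≡ fromℕ (cum T i d) ℚ.* half^ d
  cum-prob i zero    = probOutAt≡ i zero
  cum-prob i (suc d) = begin
    sumUpTo (probOutAt T i) d ℚ.+ probOutAt T i (suc d)
      ≡⟨ cong₂ ℚ._+_ (cum-prob i d) (probOutAt≡ i (suc d)) ⟩
    fromℕ (cum T i d) ℚ.* half^ d ℚ.+ fromℕ (leaves T i (suc d)) ℚ.* half^ (suc d)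
      ≡⟨ cong (ℚ._+ fromℕ (leaves T i (suc d)) ℚ.* half^ (suc d)) (doubled (cum T i d)) ⟩
    fromℕ (2 * cum T i d) ℚ.* half^ (suc d) ℚ.+ fromℕ (leaves T i (suc d)) ℚ.* half^ (suc d)
      ≡⟨ ℚ.*-distribʳ-+ (half^ (suc d)) (fromℕ (2 * cum T i d)) (fromℕ (leaves T i (suc d))) ⟨
    (fromℕ (2 * cum T i d) ℚ.+ fromℕ (leaves T i (suc d))) ℚ.* half^ (suc d)
      ≡⟨ cong (ℚ._* half^ (suc d)) (fromℕ-+ (2 * cum T i d) (leaves T i (suc d))) ⟨
    fromℕ (cum T i (suc d)) ℚ.* half^ (suc d) ∎
    where
    open ≡-Reasoning
    doubled : ∀ a → fromℕ a ℚ.* half^ d ≡ fromℕ (2 * a) ℚ.* half^ (suc d)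
    doubled a = sym (trans (sym (ℚ.+-identityʳ (fromℕ (2 * a) ℚ.* half^ (suc d))))
      (trans (cong (fromℕ (2 * a) ℚ.* half^ (suc d) ℚ.+_) (sym (ℚ.*-zeroˡ (half^ (suc d)))))
             (half^-merge (2 * a) 0 a (half^ d) (+-identityʳ (2 * a)))))

  probOutAt≥0 : ∀ i j → 0ℚ ℚ.≤ probOutAt T i j
  probOutAt≥0 i j = subst (0ℚ ℚ.≤_) (sym (probOutAt≡ i j))
    (dyadic≥0 (leaves T i j) j)

  -- Sum of the probabilities of consuming more than j bits, over j < d.
  truncBits : ℕ → ℚ
  truncBits zero    = 0ℚ
  truncBits (suc d) = truncBits d ℚ.+ aliveProb d

  truncBits-mono : ∀ d k → truncBits d ℚ.≤ truncBits (d + k)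
  truncBits-mono d zero rewrite +-identityʳ d = ℚ.≤-refl
  truncBits-mono d (suc k) rewrite +-suc d k =
    ℚ.≤-trans (truncBits-mono d k) (p≤p+nonNeg (truncBits (d + k)) (aliveProb≥0 (d + k)))

  -- Summation by parts. Both sides are E[min(bits, d)]: runs that have halted count their bits, and
  -- runs still alive at depth `d` count `d`.
  expBits-abel : ∀ d → expBitsUpTo T d ℚ.+ fromℕ d ℚ.* aliveProb d ≡ truncBits d
  expBits-abel zero = cong₂ ℚ._+_ (ℚ.*-zeroˡ (probHaltAt T 0)) (ℚ.*-zeroˡ (aliveProb 0))
  expBits-abel (suc d) = begin
    e ℚ.+ fromℕ (suc d) ℚ.* h ℚ.+ fromℕ (suc d) ℚ.* b
      ≡⟨ trans (ℚ.+-assoc e (fromℕ (suc d) ℚ.* h) (fromℕ (suc d) ℚ.* b)) (cong (e ℚ.+_) (sym (ℚ.*-distribˡ-+ (fromℕ (suc d)) h b))) ⟩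
    e ℚ.+ fromℕ (suc d) ℚ.* (h ℚ.+ b)
      ≡⟨ cong₂ (λ m p → e ℚ.+ m ℚ.* p) (fromℕ-+ 1 d) (probHaltAt+aliveProb d) ⟩
    e ℚ.+ (1ℚ ℚ.+ fromℕ d) ℚ.* a
      ≡⟨ solve 3 (λ e m a → e :+ (con 1ℚ :+ m) :* a := e :+ m :* a :+ a) refl e (fromℕ d) a ⟩
    e ℚ.+ fromℕ d ℚ.* a ℚ.+ a
      ≡⟨ cong (ℚ._+ a) (expBits-abel d) ⟩
    truncBits d ℚ.+ a ∎
    where
    open ≡-Reasoning
    e = expBitsUpTo T d
    h = probHaltAt T (suc d)
    b = aliveProb (suc d)
    a = aliveProb d

  expBits≤truncBits : ∀ d → expBitsUpTo T d ℚ.≤ truncBits d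
  expBits≤truncBits d = subst (expBitsUpTo T d ℚ.≤_) (expBits-abel d)
    (p≤p+nonNeg (expBitsUpTo T d) (*-nonNeg (fromℕ d) (aliveProb d) (fromℕ-nonNeg d) (ℚ.nonNegative (aliveProb≥0 d))))

  -- Runs halting after depth `d` contribute at least `d` bits each; the runs still alive at depth
  -- `d + k` are the only ones missing, and their share tends to 0 as `k` grows.
  truncBits≤expBits : ∀ d k → truncBits d ℚ.≤ expBitsUpTo T (d + k) ℚ.+ fromℕ d ℚ.* aliveProb (d + k)
  truncBits≤expBits d zero rewrite +-identityʳ d = ℚ.≤-reflexive (sym (expBits-abel d))
  truncBits≤expBits d (suc k) rewrite +-suc d k = begin
    truncBits d
      ≤⟨ truncBits≤expBits d k ⟩
    e ℚ.+ fromℕ d ℚ.* aliveProb (d + k)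
      ≡⟨ cong (λ p → e ℚ.+ fromℕ d ℚ.* p) (probHaltAt+aliveProb (d + k)) ⟨
    e ℚ.+ fromℕ d ℚ.* (h ℚ.+ b)
      ≡⟨ trans (cong (e ℚ.+_) (ℚ.*-distribˡ-+ (fromℕ d) h b)) (sym (ℚ.+-assoc e (fromℕ d ℚ.* h) (fromℕ d ℚ.* b))) ⟩
    e ℚ.+ fromℕ d ℚ.* h ℚ.+ fromℕ d ℚ.* b
      ≤⟨ ℚ.+-monoˡ-≤ (fromℕ d ℚ.* b) (ℚ.+-monoʳ-≤ e (*-monoˡ h (ℚ.nonNegative (probHaltAt≥0 (suc (d + k))))
           (fromℕ-mono d (suc (d + k)) (m≤n⇒m≤1+n (m≤m+n d k))))) ⟩
    e ℚ.+ fromℕ (suc (d + k)) ℚ.* h ℚ.+ fromℕ d ℚ.* b ∎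
    where
    open ℚ.≤-Reasoning
    e = expBitsUpTo T (d + k)
    h = probHaltAt T (suc (d + k))
    b = aliveProb (suc (d + k))

-- Comparison of expected bits through branch counts

module _ (M : Fin n → ℕ) .{{_ : NonZero (sumFin M)}} where

  private
    Z : ℕ
    Z = sumFin M

    p : Fin n → ℚ
    p i = ratio (M i) Z

  module _ {T : DDG n} (outT : HasOutput T p) where

    cum-bound : ∀ i d → Z * cum T i d ≤ 2 ^ d * M i
    cum-bound i d = dyadic≤ratio⇒ Z (M i) d (cum T i d) (subst (ℚ._≤ p i) (cum-prob T i d)
      (Limit-lower-bound (sumUpTo-mono (probOutAt≥0 T i)) (outT i) d))

    -- Merges the limits of the single outcomes into one, with half of the tolerance spent on each
    -- new outcome. For `allFin n` it says that the halting probability tends to `ratio Z Z`.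
    ratio-approx : ∀ xs {ε} → 0ℚ ℚ.< ε →
      ∃[ N ] (∀ d → N ≤ d → ratio (Σ xs M) Z ℚ.≤ fromℕ (Σ xs (λ i → cum T i d)) ℚ.* half^ d ℚ.+ ε)
    ratio-approx [] {ε} 0<ε = 0 , λ d _ → begin
      ratio 0 Z                      ≤⟨ ratio≤dyadic Z 0 d 0 (≤-reflexive (trans (*-zeroʳ (2 ^ d)) (sym (*-zeroʳ Z)))) ⟩
      fromℕ 0 ℚ.* half^ d            ≤⟨ p≤p+nonNeg (fromℕ 0 ℚ.* half^ d) (ℚ.<⇒≤ 0<ε) ⟩
      fromℕ 0 ℚ.* half^ d ℚ.+ ε      ∎
      where open ℚ.≤-Reasoning
    ratio-approx (i ∷ xs) {ε} 0<ε = N₁ + N₂ , λ d N≤d →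
      let F = fromℕ (cum T i d) ; G = fromℕ (Σ xs (λ k → cum T k d)) ; h = half^ d in begin
      ratio (M i + Σ xs M) Z
        ≡⟨ ratio-+ (M i) (Σ xs M) Z ⟩
      p i ℚ.+ ratio (Σ xs M) Z
        ≤⟨ ℚ.+-mono-≤
             (∣a-b∣≤e⇒a≤b+e (p i) (sumUpTo (probOutAt T i) d)
               (subst (ℚ._≤ ε/2) (∣-∣-swap (sumUpTo (probOutAt T i) d) (p i))
                 (proj₂ (outT i ε/2 0<ε/2) d (m+n≤o⇒m≤o N₁ N≤d))))
             (proj₂ (ratio-approx xs 0<ε/2) d (m+n≤o⇒n≤o N₁ N≤d)) ⟩
      sumUpTo (probOutAt T i) d ℚ.+ ε/2 ℚ.+ (G ℚ.* h ℚ.+ ε/2)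
        ≡⟨ cong (λ q → q ℚ.+ ε/2 ℚ.+ (G ℚ.* h ℚ.+ ε/2)) (cum-prob T i d) ⟩
      F ℚ.* h ℚ.+ ε/2 ℚ.+ (G ℚ.* h ℚ.+ ε/2)
        ≡⟨ solve 4 (λ F G h e → F :* h :+ e :+ (G :* h :+ e) := (F :+ G) :* h :+ (e :+ e)) refl F G h ε/2 ⟩
      (F ℚ.+ G) ℚ.* h ℚ.+ (ε/2 ℚ.+ ε/2)
        ≡⟨ cong₂ (λ q r → q ℚ.* h ℚ.+ r) (sym (fromℕ-+ (cum T i d) (Σ xs (λ k → cum T k d)))) ε/2+ε/2 ⟩
      fromℕ (cum T i d + Σ xs (λ k → cum T k d)) ℚ.* h ℚ.+ ε ∎
      where
      open ℚ.≤-Reasoning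
      ε/2 = ½ ℚ.* ε
      0<ε/2 : 0ℚ ℚ.< ε/2
      0<ε/2 = subst (ℚ._< ε/2) (ℚ.*-zeroʳ ½) (ℚ.*-monoʳ-<-pos ½ 0<ε)
      ε/2+ε/2 : ε/2 ℚ.+ ε/2 ≡ ε
      ε/2+ε/2 = trans (sym (ℚ.*-distribʳ-+ ε ½ ½)) (ℚ.*-identityˡ ε)
      N₁ = proj₁ (outT i ε/2 0<ε/2)
      N₂ = proj₁ (ratio-approx xs 0<ε/2)

    -- The alive mass is what the halted mass lacks to the total mass 1, and the halted mass is
    -- within `ε` of `ratio Z Z`.
    aliveProb-vanishes : ∀ {ε} → 0ℚ ℚ.< ε → ∃[ N ] (∀ d → N ≤ d → aliveProb T d ℚ.≤ ε)
    aliveProb-vanishes {ε} 0<ε = N , λ d N≤d →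
      let S = sumFin (λ i → cum T i d) ; a = aliveProb T d ; s = fromℕ S ℚ.* half^ d in
      ℚ-cancelˡ s {a} {ε} (begin
        s ℚ.+ a                                         ≡⟨ ℚ.*-distribʳ-+ (half^ d) (fromℕ S) (fromℕ (alive T d)) ⟨
        (fromℕ S ℚ.+ fromℕ (alive T d)) ℚ.* half^ d     ≡⟨ cong (ℚ._* half^ d) (fromℕ-+ S (alive T d)) ⟨
        fromℕ (S + alive T d) ℚ.* half^ d               ≤⟨ dyadic≤ratio Z Z d (S + alive T d) (≤-reflexive (trans (cong (Z *_) (cum+alive T d)) (*-comm Z (2 ^ d)))) ⟩
        ratio Z Z                                       ≤⟨ proj₂ (ratio-approx (allFin n) 0<ε) d N≤d ⟩
        s ℚ.+ ε                                         ∎)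
      where
      open ℚ.≤-Reasoning
      N = proj₁ (ratio-approx (allFin n) 0<ε)

    truncBits-approx : ∀ d {ε} → 0ℚ ℚ.< ε → ∃[ d′ ] (truncBits T d ℚ.≤ expBitsUpTo T d′ ℚ.+ ε)
    truncBits-approx d {ε} 0<ε = d + N , (begin
      truncBits T d
        ≤⟨ truncBits≤expBits T d N ⟩
      expBitsUpTo T (d + N) ℚ.+ fromℕ d ℚ.* aliveProb T (d + N)
        ≤⟨ ℚ.+-monoʳ-≤ (expBitsUpTo T (d + N)) small ⟩
      expBitsUpTo T (d + N) ℚ.+ ε ∎)
      where
      open ℚ.≤-Reasoning
      -- This choice replaces `ε / d`: it needs no division, so `d = 0` is harmless, and
      -- `d * half^ d ≤ 1` brings the error below `ε`.
      η = half^ d ℚ.* ε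
      0<η : 0ℚ ℚ.< η
      0<η = subst (ℚ._< η) (ℚ.*-zeroʳ (half^ d)) (ℚ.*-monoʳ-<-pos (half^ d) {{half^-pos d}} 0<ε)
      N = proj₁ (aliveProb-vanishes 0<η)
      small : fromℕ d ℚ.* aliveProb T (d + N) ℚ.≤ ε
      small = begin
        fromℕ d ℚ.* aliveProb T (d + N)   ≤⟨ ℚ.*-monoˡ-≤-nonNeg (fromℕ d) {{fromℕ-nonNeg d}} (proj₂ (aliveProb-vanishes 0<η) (d + N) (m≤n+m N d)) ⟩
        fromℕ d ℚ.* (half^ d ℚ.* ε)       ≡⟨ ℚ.*-assoc (fromℕ d) (half^ d) ε ⟨
        fromℕ d ℚ.* half^ d ℚ.* ε         ≤⟨ *-monoˡ ε (ℚ.nonNegative (ℚ.<⇒≤ 0<ε)) (fromℕ-half^ d) ⟩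
        1ℚ ℚ.* ε                          ≡⟨ ℚ.*-identityˡ ε ⟩
        ε                                 ∎

  truncBits-alive-mono : ∀ {T T′ : DDG n} → (∀ j → alive T j ≤ alive T′ j) →
    ∀ d → truncBits T d ℚ.≤ truncBits T′ d
  truncBits-alive-mono le zero    = ℚ.≤-refl
  truncBits-alive-mono {T} {T′} le (suc d) = ℚ.+-mono-≤ (truncBits-alive-mono {T} {T′} le d)
    (dyadic-mono d (le d))

  -- `truncBits` is monotone in the branch counts, bounds the partial expectations of `T` from
  -- above, and is approximated by those of any competitor.
  leastAlive⇒optimal : ∀ {T} → HasOutput T p →
    (∀ T′ → HasOutput T′ p → ∀ j → alive T j ≤ alive T′ j) → EntropyOptimal T p
  leastAlive⇒optimal {T} outT least = outT , λ T′ outT′ d ε 0<ε →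
    let d′ , le = truncBits-approx outT′ d 0<ε in
    d′ , ℚ.≤-trans (expBits≤truncBits T d)
           (ℚ.≤-trans (truncBits-alive-mono {T} {T′} (least T′ outT′) d) le)

  module _ {T* T : DDG n} (outT : HasOutput T p) (T≤T* : ExpBits≤ T T*)
           (least : ∀ j → alive T* j ≤ alive T j) {C : ℕ} (bounded : ∀ j → alive T* j ≤ C)
           where

    private
      2Ch : ℕ → ℚ
      2Ch d = fromℕ (2 * C) ℚ.* half^ d

    -- Geometric tail estimate: the step from depth m adds at most `C * half^ m`, which is exactly
    -- the drop from `2Ch m` to `2Ch (suc m)`.
    truncBits-tail : ∀ d k → truncBits T* (d + k) ℚ.+ 2Ch (d + k) ℚ.≤ truncBits T* d ℚ.+ 2Ch d
    truncBits-tail d zero rewrite +-identityʳ d = ℚ.≤-refl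
    truncBits-tail d (suc k) rewrite +-suc d k = begin
      t ℚ.+ aliveProb T* m ℚ.+ 2Ch (suc m)
        ≤⟨ ℚ.+-monoˡ-≤ (2Ch (suc m)) (ℚ.+-monoʳ-≤ t (dyadic-mono m (bounded m))) ⟩
      t ℚ.+ fromℕ C ℚ.* half^ m ℚ.+ 2Ch (suc m)
        ≡⟨ ℚ.+-assoc t (fromℕ C ℚ.* half^ m) (2Ch (suc m)) ⟩
      t ℚ.+ (fromℕ C ℚ.* half^ m ℚ.+ 2Ch (suc m))
        ≡⟨ cong (λ q → t ℚ.+ (q ℚ.+ 2Ch (suc m))) doubled ⟩
      t ℚ.+ (2Ch (suc m) ℚ.+ 2Ch (suc m))
        ≡⟨ cong (t ℚ.+_) (half^-merge (2 * C) (2 * C) (2 * C) (half^ m) (cong (2 * C +_) (sym (+-identityʳ (2 * C))))) ⟩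
      t ℚ.+ 2Ch m
        ≤⟨ truncBits-tail d k ⟩
      truncBits T* d ℚ.+ 2Ch d ∎
      where
      open ℚ.≤-Reasoning
      m = d + k
      t = truncBits T* m
      doubled : fromℕ C ℚ.* half^ m ≡ 2Ch (suc m)
      doubled = sym (trans (sym (ℚ.+-identityʳ (2Ch (suc m))))
        (trans (cong (2Ch (suc m) ℚ.+_) (sym (ℚ.*-zeroˡ (half^ (suc m)))))
               (half^-merge (2 * C) 0 C (half^ m) (+-identityʳ (2 * C)))))

    truncBits-bound : ∀ d d′ → truncBits T* d′ ℚ.≤ truncBits T* d ℚ.+ 2Ch d
    truncBits-bound d d′ = begin
      truncBits T* d′                         ≤⟨ truncBits-mono T* d′ d ⟩
      truncBits T* (d′ + d)                   ≡⟨ cong (truncBits T*) (+-comm d′ d) ⟩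
      truncBits T* (d + d′)                   ≤⟨ p≤p+nonNeg (truncBits T* (d + d′)) (dyadic≥0 (2 * C) (d + d′)) ⟩
      truncBits T* (d + d′) ℚ.+ 2Ch (d + d′)  ≤⟨ truncBits-tail d d′ ⟩
      truncBits T* d ℚ.+ 2Ch d                ∎
      where open ℚ.≤-Reasoning

    -- One surplus branch node at depth `j` contributes `half^ j`, and no later depth can win it
    -- back because `T*` is least at every depth.
    truncBits-gap : ∀ j → alive T* j < alive T j → ∀ k →
      truncBits T* (suc j + k) ℚ.+ half^ j ℚ.≤ truncBits T (suc j + k)
    truncBits-gap j lt zero rewrite +-identityʳ j = begin
      truncBits T* j ℚ.+ aliveProb T* j ℚ.+ half^ j
        ≡⟨ solve 3 (λ t a h → t :+ a :* h :+ h := t :+ (con 1ℚ :+ a) :* h) refl (truncBits T* j) (fromℕ (alive T* j)) (half^ j) ⟩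
      truncBits T* j ℚ.+ (1ℚ ℚ.+ fromℕ (alive T* j)) ℚ.* half^ j
        ≡⟨ cong (λ q → truncBits T* j ℚ.+ q ℚ.* half^ j) (fromℕ-+ 1 (alive T* j)) ⟨
      truncBits T* j ℚ.+ fromℕ (suc (alive T* j)) ℚ.* half^ j
        ≤⟨ ℚ.+-mono-≤ (truncBits-alive-mono {T*} {T} least j) (dyadic-mono j lt) ⟩
      truncBits T j ℚ.+ aliveProb T j ∎
      where open ℚ.≤-Reasoning
    truncBits-gap j lt (suc k) rewrite +-suc j k = begin
      truncBits T* m ℚ.+ aliveProb T* m ℚ.+ half^ j
        ≡⟨ solve 3 (λ t a h → t :+ a :+ h := t :+ h :+ a) refl (truncBits T* m) (aliveProb T* m) (half^ j) ⟩
      truncBits T* m ℚ.+ half^ j ℚ.+ aliveProb T* m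
        ≤⟨ ℚ.+-mono-≤ (truncBits-gap j lt k) (dyadic-mono m (least m)) ⟩
      truncBits T m ℚ.+ aliveProb T m ∎
      where
      open ℚ.≤-Reasoning
      m = suc j + k

    ¬excess : ∀ j → ¬ (alive T* j < alive T j)
    ¬excess j lt = ℚ.<-irrefl refl (begin-strict
      half^ j
        ≤⟨ ℚ-cancelˡ (truncBits T* D) {half^ j} {2Ch D ℚ.+ h ℚ.+ h} gap ⟩
      2Ch D ℚ.+ h ℚ.+ h
        <⟨ subst (ℚ._< 2Ch D ℚ.+ h ℚ.+ h ℚ.+ h) (ℚ.+-identityʳ (2Ch D ℚ.+ h ℚ.+ h)) (ℚ.+-monoʳ-< (2Ch D ℚ.+ h ℚ.+ h) 0<h) ⟩
      2Ch D ℚ.+ h ℚ.+ h ℚ.+ h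
        ≡⟨ solve 2 (λ c h → c :* h :+ h :+ h :+ h := (con 1ℚ :+ (con 1ℚ :+ (con 1ℚ :+ c))) :* h) refl (fromℕ (2 * C)) h ⟩
      (1ℚ ℚ.+ (1ℚ ℚ.+ (1ℚ ℚ.+ fromℕ (2 * C)))) ℚ.* h
        ≡⟨ cong (ℚ._* h) fromℕ-K ⟨
      fromℕ K ℚ.* h
        ≡⟨ cong (fromℕ K ℚ.*_) (trans (cong half^ (sym (+-suc j (2 + 2 * C)))) (half^-+ j K)) ⟩
      fromℕ K ℚ.* (half^ j ℚ.* half^ K)
        ≡⟨ solve 3 (λ k a b → k :* (a :* b) := k :* b :* a) refl (fromℕ K) (half^ j) (half^ K) ⟩
      fromℕ K ℚ.* half^ K ℚ.* half^ j
        ≤⟨ *-monoˡ (half^ j) (half^-nonNeg j) (fromℕ-half^ K) ⟩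
      1ℚ ℚ.* half^ j
        ≡⟨ ℚ.*-identityˡ (half^ j) ⟩
      half^ j ∎)
      where
      open ℚ.≤-Reasoning
      -- At depth `D = j + K` the error is `2 * C` units of `h` for the tail of `T*` and one for
      -- each of the two tolerances. A third extra unit makes the inequality strict, while
      -- `K * half^ K ≤ 1` keeps the total at most `half^ j`.
      K = 3 + 2 * C
      D = suc j + (2 + 2 * C)
      h = half^ D
      0<h : 0ℚ ℚ.< h
      0<h = ℚ.positive⁻¹ h {{half^-pos D}}
      fromℕ-K : fromℕ K ≡ 1ℚ ℚ.+ (1ℚ ℚ.+ (1ℚ ℚ.+ fromℕ (2 * C)))
      fromℕ-K = trans (fromℕ-+ 1 (2 + 2 * C)) (cong (1ℚ ℚ.+_)
        (trans (fromℕ-+ 1 (1 + 2 * C)) (cong (1ℚ ℚ.+_) (fromℕ-+ 1 (2 * C)))))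
      d₁ = proj₁ (truncBits-approx outT D 0<h)
      d₂ = proj₁ (T≤T* d₁ h 0<h)
      gap : truncBits T* D ℚ.+ half^ j ℚ.≤ truncBits T* D ℚ.+ (2Ch D ℚ.+ h ℚ.+ h)
      gap = begin
        truncBits T* D ℚ.+ half^ j             ≤⟨ truncBits-gap j lt (2 + 2 * C) ⟩
        truncBits T D                          ≤⟨ proj₂ (truncBits-approx outT D 0<h) ⟩
        expBitsUpTo T d₁ ℚ.+ h                 ≤⟨ ℚ.+-monoˡ-≤ h (proj₂ (T≤T* d₁ h 0<h)) ⟩
        expBitsUpTo T* d₂ ℚ.+ h ℚ.+ h          ≤⟨ ℚ.+-monoˡ-≤ h (ℚ.+-monoˡ-≤ h (ℚ.≤-trans (expBits≤truncBits T* d₂) (truncBits-bound D d₂))) ⟩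
        truncBits T* D ℚ.+ 2Ch D ℚ.+ h ℚ.+ h   ≡⟨ solve 3 (λ t c h → t :+ c :+ h :+ h := t :+ (c :+ h :+ h)) refl (truncBits T* D) (2Ch D) h ⟩
        truncBits T* D ℚ.+ (2Ch D ℚ.+ h ℚ.+ h) ∎

    optimal⇒leastAlive : ∀ j → alive T j ≡ alive T* j
    optimal⇒leastAlive j = ≤-antisym (≮⇒≥ (¬excess j)) (least j)

-- Digits modulo Z and the periodic tree

sumTo : (ℕ → ℕ) → ℕ → ℕ
sumTo f zero    = 0
sumTo f (suc k) = f 0 + sumTo (f ∘ suc) k

sumTo-cong : ∀ {f g} k → (∀ m → m < k → f m ≡ g m) → sumTo f k ≡ sumTo g k
sumTo-cong zero    eq = refl
sumTo-cong (suc k) eq = cong₂ _+_ (eq 0 z<s) (sumTo-cong k (λ m m<k → eq (suc m) (s<s m<k)))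

sumTo-zero : ∀ f k → (∀ m → f m ≡ 0) → sumTo f k ≡ 0
sumTo-zero f zero    f≡0 = refl
sumTo-zero f (suc k) f≡0 = cong₂ _+_ (f≡0 0) (sumTo-zero (f ∘ suc) k (f≡0 ∘ suc))

sumTo-+ : ∀ f a b → sumTo f (a + b) ≡ sumTo f a + sumTo (λ m → f (a + m)) b
sumTo-+ f zero    b = refl
sumTo-+ f (suc a) b = trans (cong (f 0 +_) (sumTo-+ (f ∘ suc) a b)) (sym (+-assoc (f 0) _ _))

-- In `tree` the node with index `m` has children with indices `1 + 2 * m` (bit `true`) and `2 * m`
-- (bit `false`); the pairing follows that order.
sumTo-pairs : ∀ f k → sumTo f (2 * k) ≡ sumTo (λ m → f (1 + 2 * m) + f (2 * m)) k
sumTo-pairs f zero    = refl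
sumTo-pairs f (suc k) rewrite +-suc k (k + 0) = begin
  f 0 + (f 1 + sumTo f₂ (2 * k))
    ≡⟨ trans (sym (+-assoc (f 0) (f 1) _)) (cong (_+ sumTo f₂ (2 * k)) (+-comm (f 0) (f 1))) ⟩
  f 1 + f 0 + sumTo f₂ (2 * k)
    ≡⟨ cong (f 1 + f 0 +_) (sumTo-pairs f₂ k) ⟩
  f 1 + f 0 + sumTo (λ m → f (3 + 2 * m) + f (2 + 2 * m)) k
    ≡⟨ cong (f 1 + f 0 +_) (sumTo-cong k λ m _ → cong (λ l → f (suc l) + f l) (sym (*-suc 2 m))) ⟩
  f 1 + f 0 + sumTo (λ m → f (1 + 2 * suc m) + f (2 * suc m)) k ∎
  where
  open ≡-Reasoning
  f₂ : ℕ → ℕ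
  f₂ m = f (2 + m)

Σ-replicate : (f : Fin n → ℕ) → ∀ k i ys → Σ (replicate k i ++ ys) f ≡ k * f i + Σ ys f
Σ-replicate f zero    i ys = refl
Σ-replicate f (suc k) i ys = trans (cong (f i +_) (Σ-replicate f k i ys)) (sym (+-assoc (f i) _ _))

Σ-concatMap-replicate : (e f : Fin n → ℕ) → ∀ xs →
  Σ (concatMap (λ i → replicate (e i) i) xs) f ≡ Σ xs (λ i → e i * f i)
Σ-concatMap-replicate e f []       = refl
Σ-concatMap-replicate e f (i ∷ xs) = trans (Σ-replicate f (e i) i _)
  (cong (e i * f i +_) (Σ-concatMap-replicate e f xs))

length≡Σ1 : (xs : List (Fin n)) → length xs ≡ Σ xs (λ _ → 1)
length≡Σ1 []       = refl
length≡Σ1 (x ∷ xs) = cong suc (length≡Σ1 xs)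

sumFin-select : (e : Fin n → ℕ) → ∀ i → sumFin (λ k → e k * indicator (does (i ≟F k))) ≡ e i
sumFin-select {suc n} e zero = trans (sumFin-suc selected) (trans
  (cong₂ _+_ (*-identityʳ (e zero)) (Σ-zero (selected ∘ suc) (λ k → *-zeroʳ (e (suc k))) (allFin n)))
  (+-identityʳ (e zero)))
  where
  selected : Fin (suc n) → ℕ
  selected k = e k * indicator (does (zero ≟F k))
sumFin-select {suc n} e (suc i) = trans (sumFin-suc selected)
  (cong₂ _+_ (*-zeroʳ (e zero)) (sumFin-select (e ∘ suc) i))
  where
  selected : Fin (suc n) → ℕ
  selected k = e k * indicator (does (suc i ≟F k))

-- Arithmetic of residues, primitive roots

[m%n*o]%n≡[m*o]%n : ∀ m o n .{{_ : NonZero n}} → (m % n * o) % n ≡ (m * o) % n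
[m%n*o]%n≡[m*o]%n m o n = begin
  (m % n * o) % n               ≡⟨ %-distribˡ-* (m % n) o n ⟩
  (m % n % n * (o % n)) % n     ≡⟨ cong (λ r → (r * (o % n)) % n) (m%n%n≡m%n m n) ⟩
  (m % n * (o % n)) % n         ≡⟨ %-distribˡ-* m o n ⟨
  (m * o) % n                   ∎
  where open ≡-Reasoning

[m*[o%n]]%n≡[m*o]%n : ∀ m o n .{{_ : NonZero n}} → (m * (o % n)) % n ≡ (m * o) % n
[m*[o%n]]%n≡[m*o]%n m o n = begin
  (m * (o % n)) % n   ≡⟨ cong (_% n) (*-comm m (o % n)) ⟩
  (o % n * m) % n     ≡⟨ [m%n*o]%n≡[m*o]%n o m n ⟩
  (o * m) % n         ≡⟨ cong (_% n) (*-comm o m) ⟩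
  (m * o) % n         ∎
  where open ≡-Reasoning

2*m%2≡0 : ∀ m → 2 * m % 2 ≡ 0
2*m%2≡0 m = trans (cong (_% 2) (*-comm 2 m)) (m*n%n≡0 m 2)

-- Doubling wraps around at most once. The number `2 * r` is even, and subtracting the odd `z` makes
-- it odd, so the carry, which is the next binary digit of r / z, equals the parity of the new
-- remainder.
double-mod : ∀ r z .{{_ : NonZero z}} → z % 2 ≡ 1 → r < z →
  2 * r ≡ (2 * r) % z + z * ((2 * r) % z % 2)
double-mod r z z-odd r<z with 2 * r <? z
... | yes 2r<z = begin
  2 * r                                 ≡⟨ +-identityʳ (2 * r) ⟨
  2 * r + 0                             ≡⟨ cong (2 * r +_) (*-zeroʳ z) ⟨
  2 * r + z * 0                         ≡⟨ cong (λ t → 2 * r + z * t) (2*m%2≡0 r) ⟨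
  2 * r + z * (2 * r % 2)               ≡⟨ cong (λ t → t + z * (t % 2)) (m<n⇒m%n≡m 2r<z) ⟨
  (2 * r) % z + z * ((2 * r) % z % 2)   ∎
  where open ≡-Reasoning
... | no  2r≮z = begin
  2 * r                            ≡⟨ 2r≡ ⟩
  s + z                            ≡⟨ cong (s +_) (*-identityʳ z) ⟨
  s + z * 1                        ≡⟨ cong (λ t → s + z * t) s-odd ⟨
  s + z * (s % 2)                  ≡⟨ cong (λ t → t + z * (t % 2)) s≡ ⟨
  (2 * r) % z + z * ((2 * r) % z % 2) ∎
  where
  open ≡-Reasoning
  s = 2 * r ∸ z
  2r≡ : 2 * r ≡ s + z
  2r≡ = sym (m∸n+n≡m (≮⇒≥ 2r≮z))
  s<z : s < z
  s<z = +-cancelʳ-< z s z (subst₂ _<_ 2r≡ (cong (z +_) (+-identityʳ z)) (*-monoʳ-< 2 r<z))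
  s≡ : (2 * r) % z ≡ s
  s≡ = trans (cong (_% z) 2r≡) (trans ([m+n]%n≡m%n s z) (m<n⇒m%n≡m s<z))
  s-odd : s % 2 ≡ 1
  s-odd with s % 2 in s%2 | m%n<n s 2
  ... | 1 | _ = refl
  ... | 0 | _ = contradiction (trans (sym (begin
    (2 * r) % 2              ≡⟨ cong (_% 2) 2r≡ ⟩
    (s + z) % 2              ≡⟨ %-distribˡ-+ s z 2 ⟩
    (s % 2 + z % 2) % 2      ≡⟨ cong₂ (λ a b → (a + b) % 2) s%2 z-odd ⟩
    1                        ∎)) (trans (cong (_% 2) (*-comm 2 r)) (m*n%n≡0 r 2))) λ ()
  ... | suc (suc _) | s≤s (s≤s ())

m%n≡o%n⇒n∣o∸m : ∀ m o n .{{_ : NonZero n}} → m % n ≡ o % n → n ∣ o ∸ m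
m%n≡o%n⇒n∣o∸m m o n eq = divides (o / n ∸ m / n) (begin
  o ∸ m                                          ≡⟨ cong₂ _∸_ (m≡m%n+[m/n]*n o n) (m≡m%n+[m/n]*n m n) ⟩
  (o % n + o / n * n) ∸ (m % n + m / n * n)      ≡⟨ cong (λ r → (o % n + o / n * n) ∸ (r + m / n * n)) eq ⟩
  (o % n + o / n * n) ∸ (o % n + m / n * n)      ≡⟨ [m+n]∸[m+o]≡n∸o (o % n) (o / n * n) (m / n * n) ⟩
  o / n * n ∸ m / n * n                          ≡⟨ *-distribʳ-∸ n (o / n) (m / n) ⟨
  (o / n ∸ m / n) * n                            ∎)
  where open ≡-Reasoning

totient-prime : ∀ {p} → Prime p → totient p ≡ p ∸ 1
totient-prime {suc p} pp = begin
  length (filter C? (map suc (upTo (suc p))))          ≡⟨ cong (length ∘ filter C?) (trans (map-upTo suc (suc p)) (sym (applyUpTo-∷ʳ suc p))) ⟩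
  length (filter C? (applyUpTo suc p ∷ʳ suc p))        ≡⟨ cong length (filter-++ C? (applyUpTo suc p) (suc p ∷ [])) ⟩
  length (filter C? (applyUpTo suc p) ++ filter C? (suc p ∷ []))
    ≡⟨ cong length (cong₂ _++_ (filter-all C? (applyUpTo⁺₁ suc p below)) (filter-none C? {xs = suc p ∷ []} (self ∷ []))) ⟩
  length (applyUpTo suc p ++ [])                       ≡⟨ cong length (++-identityʳ (applyUpTo suc p)) ⟩
  length (applyUpTo suc p)                             ≡⟨ length-applyUpTo suc p ⟩
  p                                                    ∎
  where
  open ≡-Reasoning
  C? = λ k → coprime? k (suc p)
  below : ∀ {i} → i < p → Coprime (suc i) (suc p)
  below i<p = coprime-sym (prime⇒coprime pp (s<s i<p))
  self : ¬ Coprime (suc p) (suc p)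
  self c with c (∣-refl , ∣-refl) | prime⇒nonTrivial pp
  ... | refl | ()

PrimitiveRoot⇒coprime : ∀ {g m} → PrimitiveRoot g m → Coprime g m
PrimitiveRoot⇒coprime {m = suc _} (c , _ , _) = c

PrimitiveRoot⇒^totient : ∀ {g m} .{{_ : NonZero m}} → PrimitiveRoot g m → g ^ totient m % m ≡ 1 % m
PrimitiveRoot⇒^totient {m = suc _} (_ , eq , _) = eq

PrimitiveRoot⇒order : ∀ {g m} .{{_ : NonZero m}} → PrimitiveRoot g m →
  ∀ k → 0 < k → k < totient m → ¬ (g ^ k % m ≡ 1 % m)
PrimitiveRoot⇒order {m = suc _} (_ , _ , order) = order

coprime2⇒odd : ∀ {m} → Coprime 2 m → m % 2 ≡ 1
coprime2⇒odd {m} c with m % 2 in eq | m%n<n m 2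
... | 0 | _ with c (∣-refl , m%n≡0⇒n∣m m 2 eq)
...   | ()
coprime2⇒odd {m} c | 1 | _ = refl
coprime2⇒odd {m} c | suc (suc _) | s≤s (s≤s ())

-- Layout of one level: `b` branch nodes at the lowest indices, then the leaves in the order of the
-- list. Indices beyond the list get the default `i₀`; by `double-width`, children of branch nodes
-- never land there.
labelAt : Fin n → ℕ → List (Fin n) → ℕ → Label n
labelAt i₀ (suc b) is       zero    = branch
labelAt i₀ (suc b) is       (suc m) = labelAt i₀ b is m
labelAt i₀ zero    []       m       = leaf i₀
labelAt i₀ zero    (i ∷ is) zero    = leaf i
labelAt i₀ zero    (i ∷ is) (suc m) = labelAt i₀ zero is m

module _ (i₀ : Fin n) where

  labelAt-< : ∀ {b m} is → m < b → labelAt i₀ b is m ≡ branch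
  labelAt-< {suc b} {zero}  is _         = refl
  labelAt-< {suc b} {suc m} is (s≤s m<b) = labelAt-< is m<b

  labelAt-≥ : ∀ b is k → ∃[ i ] (labelAt i₀ b is (b + k) ≡ leaf i)
  labelAt-≥ (suc b) is       k       = labelAt-≥ b is k
  labelAt-≥ zero    []       k       = i₀ , refl
  labelAt-≥ zero    (i ∷ is) zero    = i , refl
  labelAt-≥ zero    (i ∷ is) (suc k) = labelAt-≥ zero is k

  labelAt-branch : ∀ b is m → labelAt i₀ b is m ≡ branch → m < b
  labelAt-branch (suc b) is       zero    eq = z<s
  labelAt-branch (suc b) is       (suc m) eq = s<s (labelAt-branch b is m eq)
  labelAt-branch zero    (i ∷ is) (suc m) eq = contradiction (labelAt-branch zero is m eq) λ ()

  sumTo-labelAt : ∀ f → f branch ≡ 0 → ∀ b is →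
    sumTo (f ∘ labelAt i₀ b is) (b + length is) ≡ Σ is (f ∘ leaf)
  sumTo-labelAt f f≡0 (suc b) is       = cong₂ _+_ f≡0 (sumTo-labelAt f f≡0 b is)
  sumTo-labelAt f f≡0 zero    []       = refl
  sumTo-labelAt f f≡0 zero    (i ∷ is) = cong (f (leaf i) +_) (sumTo-labelAt f f≡0 zero is)

bit : Bool → ℕ
bit true  = 1
bit false = 0

bit≤1 : ∀ b → bit b ≤ 1
bit≤1 true  = ≤-refl
bit≤1 false = z≤n

walk-branch : (T : DDG n) → ∀ {v} → c T v ≡ branch → ∀ b bs → walk T v (b ∷ bs) ≡ walk T (δ T v b) bs
walk-branch T eq b bs rewrite eq = refl

walk-leaf : (T : DDG n) → ∀ {v i} → c T v ≡ leaf i → ∀ b bs → walk T v (b ∷ bs) ≡ nothing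
walk-leaf T eq b bs rewrite eq = refl

-- The tree whose levels are residues modulo Z

module _ (M : Fin n → ℕ) (i₀ : Fin n) .{{_ : NonZero (sumFin M)}} where

  private
    Z : ℕ
    Z = sumFin M

  residue : Fin n → ℕ → ℕ
  residue i x = (x * M i) % Z

  -- For `x = 2 ^ d % Z` this is the sum of the fractional parts of 2 ^ d pᵢ, that is 2 ^ d - Σᵢ ⌊2
  -- ^ d pᵢ⌋, the least possible number of branch nodes at depth d. The division is exact by
  -- `Z*width`.
  width : ℕ → ℕ
  width x = sumFin (λ i → residue i x) / Z

  labels : ℕ → List (Fin n)
  labels x = concatMap (λ i → replicate (residue i x % 2) i) (allFin n)

  -- A node is a pair of a level x = 2 ^ depth % Z and an index m on that level.
  node : ℕ → ℕ → ℕ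
  node x m = x + m * Z

  -- A step down doubles the level modulo `Z`, so no depth is stored, and the edge back to the root
  -- appears as soon as the power of 2 returns to 1.
  tree : DDG n
  tree = record
    { root = node 1 0
    ; c    = λ v → labelAt i₀ (width (v % Z)) (labels (v % Z)) (v / Z)
    ; δ    = λ v b → node ((2 * (v % Z)) % Z) (bit b + 2 * (v / Z))
    }

  node-% : ∀ {x} → x < Z → ∀ m → node x m % Z ≡ x
  node-% {x} x<Z m = trans ([m+kn]%n≡m%n x m Z) (m<n⇒m%n≡m x<Z)

  node-/ : ∀ {x} → x < Z → ∀ m → node x m / Z ≡ m
  node-/ {x} x<Z m = trans (+-distrib-/-∣ʳ x (n∣m*n m)) (cong₂ _+_ (m<n⇒m/n≡0 x<Z) (m*n/n≡m m Z))

  c-node : ∀ {x} → x < Z → ∀ m → c tree (node x m) ≡ labelAt i₀ (width x) (labels x) m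
  c-node x<Z m rewrite node-% x<Z m | node-/ x<Z m = refl

  δ-node : ∀ {x} → x < Z → ∀ m b → δ tree (node x m) b ≡ node ((2 * x) % Z) (bit b + 2 * m)
  δ-node x<Z m b rewrite node-% x<Z m | node-/ x<Z m = refl

  c-node-branch : ∀ {x m} → x < Z → c tree (node x m) ≡ branch → m < width x
  c-node-branch {x} {m} x<Z eq = labelAt-branch i₀ (width x) (labels x) m (trans (sym (c-node x<Z m)) eq)

  Z∣Σresidue : ∀ x → ∃[ q ] (q * Z + sumFin (λ i → residue i x) ≡ x * Z)
  Z∣Σresidue x = sumFin (λ i → x * M i / Z) , (begin
    sumFin (λ i → x * M i / Z) * Z + sumFin (λ i → residue i x)
      ≡⟨ cong (_+ sumFin (λ i → residue i x)) (trans (*-comm _ Z) (sym (Σ-* Z (λ i → x * M i / Z) (allFin n)))) ⟩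
    sumFin (λ i → Z * (x * M i / Z)) + sumFin (λ i → residue i x)
      ≡⟨ Σ-+ (λ i → Z * (x * M i / Z)) (λ i → residue i x) (allFin n) ⟨
    sumFin (λ i → Z * (x * M i / Z) + residue i x)
      ≡⟨ Σ-cong (λ i → trans (+-comm _ (residue i x)) (trans (cong (residue i x +_) (*-comm Z _)) (sym (m≡m%n+[m/n]*n (x * M i) Z)))) (allFin n) ⟩
    sumFin (λ i → x * M i)
      ≡⟨ Σ-* x M (allFin n) ⟩
    x * Z ∎)
    where open ≡-Reasoning

  Z*width : ∀ x → Z * width x ≡ sumFin (λ i → residue i x)
  Z*width x with Z∣Σresidue x
  ... | q , eq = m*[n/m]≡n (∣m+n∣m⇒∣n (divides x eq) (divides q refl))

  width≤ : ∀ x → width x ≤ x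
  width≤ x = *-cancelˡ-≤ Z (begin
    Z * width x                     ≡⟨ Z*width x ⟩
    sumFin (λ i → residue i x)      ≤⟨ m≤n+m _ (proj₁ (Z∣Σresidue x) * Z) ⟩
    proj₁ (Z∣Σresidue x) * Z + sumFin (λ i → residue i x) ≡⟨ proj₂ (Z∣Σresidue x) ⟩
    x * Z                           ≡⟨ *-comm x Z ⟩
    Z * x                           ∎)
    where open ≤-Reasoning

  module _ (Z-odd : Z % 2 ≡ 1) where

    double-residue : ∀ i x → 2 * residue i x ≡ residue i ((2 * x) % Z) + Z * (residue i ((2 * x) % Z) % 2)
    double-residue i x = subst (λ r → 2 * residue i x ≡ r + Z * (r % 2)) eq
      (double-mod (residue i x) Z Z-odd (m%n<n (x * M i) Z))
      where
      open ≡-Reasoning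
      eq : (2 * residue i x) % Z ≡ residue i ((2 * x) % Z)
      eq = begin
        (2 * residue i x) % Z           ≡⟨ [m*[o%n]]%n≡[m*o]%n 2 (x * M i) Z ⟩
        (2 * (x * M i)) % Z             ≡⟨ cong (_% Z) (*-assoc 2 x (M i)) ⟨
        (2 * x * M i) % Z               ≡⟨ [m%n*o]%n≡[m*o]%n (2 * x) (M i) Z ⟨
        ((2 * x) % Z * M i) % Z         ∎

    -- `double-residue` summed over the outcomes: every carry becomes one leaf. The children of the
    -- branch nodes of level `x` thus fill the branch nodes and leaves of the next level without gap
    -- or overlap.
    double-width : ∀ x → 2 * width x ≡ width ((2 * x) % Z) + length (labels ((2 * x) % Z))
    double-width x = *-cancelˡ-≡ _ _ Z (begin
      Z * (2 * width x)
        ≡⟨ trans (sym (*-assoc Z 2 _)) (trans (cong (_* width x) (*-comm Z 2)) (*-assoc 2 Z _)) ⟩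
      2 * (Z * width x)
        ≡⟨ cong (2 *_) (Z*width x) ⟩
      2 * sumFin (λ i → residue i x)
        ≡⟨ Σ-* 2 (λ i → residue i x) (allFin n) ⟨
      sumFin (λ i → 2 * residue i x)
        ≡⟨ Σ-cong (λ i → double-residue i x) (allFin n) ⟩
      sumFin (λ i → residue i x′ + Z * e i)
        ≡⟨ Σ-+ (λ i → residue i x′) (λ i → Z * e i) (allFin n) ⟩
      sumFin (λ i → residue i x′) + sumFin (λ i → Z * e i)
        ≡⟨ cong₂ _+_ (sym (Z*width x′)) (Σ-* Z e (allFin n)) ⟩
      Z * width x′ + Z * sumFin e
        ≡⟨ cong (λ s → Z * width x′ + Z * s) length-labels ⟨
      Z * width x′ + Z * length (labels x′)
        ≡⟨ *-distribˡ-+ Z (width x′) (length (labels x′)) ⟨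
      Z * (width x′ + length (labels x′)) ∎)
      where
      open ≡-Reasoning
      x′ = (2 * x) % Z
      e : Fin n → ℕ
      e i = residue i x′ % 2
      length-labels : length (labels x′) ≡ sumFin e
      length-labels = trans (length≡Σ1 (labels x′)) (trans
        (Σ-concatMap-replicate e (λ _ → 1) (allFin n))
        (Σ-cong (λ i → *-identityʳ (e i)) (allFin n)))

    level-cnt : (Label n → ℕ) → ℕ → ℕ → ℕ
    level-cnt f x j = sumTo (λ m → cnt tree f (node x m) j) (width x)

    module _ (f : Label n → ℕ) (f-branch : f branch ≡ 0) where

      level-cnt-children : ∀ {x} → x < Z → ∀ j → let x′ = (2 * x) % Z in
        level-cnt f x (suc j) ≡ sumTo (λ m → cnt tree f (node x′ m) j) (width x′ + length (labels x′))
      level-cnt-children {x} x<Z j = begin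
        level-cnt f x (suc j)
          ≡⟨ sumTo-cong (width x) children ⟩
        sumTo (λ m → cnt tree f (node x′ (1 + 2 * m)) j + cnt tree f (node x′ (2 * m)) j) (width x)
          ≡⟨ sumTo-pairs (λ m → cnt tree f (node x′ m) j) (width x) ⟨
        sumTo (λ m → cnt tree f (node x′ m) j) (2 * width x)
          ≡⟨ cong (sumTo (λ m → cnt tree f (node x′ m) j)) (double-width x) ⟩
        sumTo (λ m → cnt tree f (node x′ m) j) (width x′ + length (labels x′)) ∎
        where
        open ≡-Reasoning
        x′ = (2 * x) % Z
        children : ∀ m → m < width x → cnt tree f (node x m) (suc j) ≡
          cnt tree f (node x′ (1 + 2 * m)) j + cnt tree f (node x′ (2 * m)) j
        children m m<w = trans
          (cnt-branch tree f (trans (c-node x<Z m) (labelAt-< i₀ (labels x) m<w)) j)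
          (cong₂ (λ v w → cnt tree f v j + cnt tree f w j) (δ-node x<Z m true) (δ-node x<Z m false))

      -- Only branch nodes pass weight down, so the leaves of each intermediate level drop out and
      -- the sum over the branch nodes reappears one level further, until the leaves of the last
      -- level remain.
      level-cnt≡ : ∀ {x} → x < Z → ∀ j → level-cnt f x (suc j) ≡ Σ (labels ((2 ^ suc j * x) % Z)) (f ∘ leaf)
      level-cnt≡ {x} x<Z zero = begin
        level-cnt f x 1
          ≡⟨ level-cnt-children x<Z 0 ⟩
        sumTo (λ m → f (c tree (node x′ m))) (width x′ + length (labels x′))
          ≡⟨ sumTo-cong (width x′ + length (labels x′)) (λ m _ → cong f (c-node (m%n<n (2 * x) Z) m)) ⟩
        sumTo (f ∘ labelAt i₀ (width x′) (labels x′)) (width x′ + length (labels x′))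
          ≡⟨ sumTo-labelAt i₀ f f-branch (width x′) (labels x′) ⟩
        Σ (labels x′) (f ∘ leaf) ∎
        where
        open ≡-Reasoning
        x′ = (2 * x) % Z
      level-cnt≡ {x} x<Z (suc j) = begin
        level-cnt f x (2 + j)
          ≡⟨ level-cnt-children x<Z (suc j) ⟩
        sumTo (λ m → cnt tree f (node x′ m) (suc j)) (width x′ + length (labels x′))
          ≡⟨ sumTo-+ (λ m → cnt tree f (node x′ m) (suc j)) (width x′) (length (labels x′)) ⟩
        level-cnt f x′ (suc j) + sumTo (λ k → cnt tree f (node x′ (width x′ + k)) (suc j)) (length (labels x′))
          ≡⟨ cong (level-cnt f x′ (suc j) +_) (sumTo-zero _ (length (labels x′)) leaves-end) ⟩
        level-cnt f x′ (suc j) + 0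
          ≡⟨ +-identityʳ _ ⟩
        level-cnt f x′ (suc j)
          ≡⟨ level-cnt≡ x′<Z j ⟩
        Σ (labels ((2 ^ suc j * x′) % Z)) (f ∘ leaf)
          ≡⟨ cong (λ y → Σ (labels y) (f ∘ leaf)) (trans ([m*[o%n]]%n≡[m*o]%n (2 ^ suc j) (2 * x) Z)
               (cong (_% Z) (trans (sym (*-assoc (2 ^ suc j) 2 x)) (cong (_* x) (*-comm (2 ^ suc j) 2))))) ⟩
        Σ (labels ((2 ^ suc (suc j) * x) % Z)) (f ∘ leaf) ∎
        where
        open ≡-Reasoning
        x′ = (2 * x) % Z
        x′<Z = m%n<n (2 * x) Z
        leaves-end : ∀ k → cnt tree f (node x′ (width x′ + k)) (suc j) ≡ 0
        leaves-end k with labelAt-≥ i₀ (width x′) (labels x′) k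
        ... | i , eq = cnt-leaf tree f (trans (c-node x′<Z (width x′ + k)) eq) j

    module _ (M>0 : ∀ i → 0 < M i) (M<Z : ∀ i → M i < Z) where

      1<Z : 1 < Z
      1<Z = ≤-<-trans (M>0 i₀) (M<Z i₀)

      -- The numerators of the remaining probabilities 2 ^ d * pᵢ mod 1, and their next bits.
      rest : Fin n → ℕ → ℕ
      rest i d = residue i (2 ^ d % Z)

      digit : Fin n → ℕ → ℕ
      digit i d = rest i d % 2

      double-rest : ∀ i d → 2 * rest i d ≡ rest i (suc d) + Z * digit i (suc d)
      double-rest i d = subst (λ y → 2 * rest i d ≡ residue i y + Z * (residue i y % 2))
        ([m*[o%n]]%n≡[m*o]%n 2 (2 ^ d) Z) (double-residue i (2 ^ d % Z))

      rest<Z : ∀ i d → rest i d < Z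
      rest<Z i d = m%n<n (2 ^ d % Z * M i) Z

      residue-1 : ∀ i → residue i 1 ≡ M i
      residue-1 i = trans (cong (_% Z) (*-identityˡ (M i))) (m<n⇒m%n≡m (M<Z i))

      width-1 : width 1 ≡ 1
      width-1 = *-cancelˡ-≡ _ _ Z (trans (Z*width 1)
        (trans (Σ-cong residue-1 (allFin n)) (sym (*-identityʳ Z))))

      rest-0 : ∀ i → rest i 0 ≡ M i
      rest-0 i = trans (cong (residue i) (m<n⇒m%n≡m 1<Z)) (residue-1 i)

      c-root : c tree (node 1 0) ≡ branch
      c-root = trans (c-node 1<Z 0) (labelAt-< i₀ (labels 1) (subst (0 <_) (sym width-1) z<s))

      leaves-0 : ∀ i → leaves tree i 0 ≡ 0
      leaves-0 i = cong (labelled i) c-root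

      leaves-tree : ∀ i j → leaves tree i (suc j) ≡ digit i (suc j)
      leaves-tree i j = begin
        leaves tree i (suc j)
          -- Since `width 1` is 1, the root is the only branch node of its level, and its count is a
          -- sum over the whole level.
          ≡⟨ +-identityʳ _ ⟨
        sumTo (λ m → cnt tree (labelled i) (node 1 m) (suc j)) 1
          ≡⟨ cong (sumTo (λ m → cnt tree (labelled i) (node 1 m) (suc j))) width-1 ⟨
        level-cnt (labelled i) 1 (suc j)
          ≡⟨ level-cnt≡ (labelled i) refl 1<Z j ⟩
        Σ (labels ((2 ^ suc j * 1) % Z)) (labelled i ∘ leaf)
          ≡⟨ cong (λ y → Σ (labels (y % Z)) (labelled i ∘ leaf)) (*-identityʳ (2 ^ suc j)) ⟩
        Σ (labels (2 ^ suc j % Z)) (labelled i ∘ leaf)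
          ≡⟨ Σ-concatMap-replicate (λ k → digit k (suc j)) (labelled i ∘ leaf) (allFin n) ⟩
        sumFin (λ k → digit k (suc j) * indicator (does (i ≟F k)))
          ≡⟨ sumFin-select (λ k → digit k (suc j)) i ⟩
        digit i (suc j) ∎
        where open ≡-Reasoning

      -- The invariant of long division of `2 ^ d * M i` by `Z`: quotient `cum tree i d`, remainder
      -- `rest i d`. The tree thus halts with output `i` as often as any tree may by depth `d`.
      cum-tree : ∀ i d → Z * cum tree i d + rest i d ≡ 2 ^ d * M i
      cum-tree i zero = trans (cong₂ (λ a b → Z * a + b) (leaves-0 i) (rest-0 i))
        (trans (cong (_+ M i) (*-zeroʳ Z)) (sym (*-identityˡ (M i))))
      cum-tree i (suc d) = begin
        Z * (2 * a + leaves tree i (suc d)) + r′   ≡⟨ cong (λ l → Z * (2 * a + l) + r′) (leaves-tree i d) ⟩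
        Z * (2 * a + e) + r′                       ≡⟨ regroup Z a e r′ ⟩
        2 * (Z * a) + (r′ + Z * e)                 ≡⟨ cong (2 * (Z * a) +_) (double-rest i d) ⟨
        2 * (Z * a) + 2 * rest i d                 ≡⟨ *-distribˡ-+ 2 (Z * a) (rest i d) ⟨
        2 * (Z * a + rest i d)                     ≡⟨ cong (2 *_) (cum-tree i d) ⟩
        2 * (2 ^ d * M i)                          ≡⟨ *-assoc 2 (2 ^ d) (M i) ⟨
        2 ^ suc d * M i                            ∎
        where
        open ≡-Reasoning
        a = cum tree i d
        e = digit i (suc d)
        r′ = rest i (suc d)
        regroup : ∀ z a e r → z * (2 * a + e) + r ≡ 2 * (z * a) + (r + z * e)
        regroup = solve-∀

      tree-output : HasOutput tree (λ i → ratio (M i) Z)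
      tree-output i = half^-close⇒Limit {sumUpTo (probOutAt tree i)} {ratio (M i) Z} λ d → subst (λ q → ∣ q ℚ.- ratio (M i) Z ∣ ℚ.≤ half^ d)
        (sym (cum-prob tree i d)) (a≤b≤a+e⇒∣a-b∣≤e (below d) (above d))
        where
        below : ∀ d → fromℕ (cum tree i d) ℚ.* half^ d ℚ.≤ ratio (M i) Z
        below d = dyadic≤ratio Z (M i) d (cum tree i d)
          (≤-trans (m≤m+n _ (rest i d)) (≤-reflexive (cum-tree i d)))
        above : ∀ d → ratio (M i) Z ℚ.≤ fromℕ (cum tree i d) ℚ.* half^ d ℚ.+ half^ d
        above d = begin
          ratio (M i) Z
            ≤⟨ ratio≤dyadic Z (M i) d (cum tree i d + 1) (≤-trans (≤-reflexive (sym (cum-tree i d)))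
                 (≤-trans (+-monoʳ-≤ (Z * cum tree i d) (<⇒≤ (rest<Z i d)))
                   (≤-reflexive (trans (cong (Z * cum tree i d +_) (sym (*-identityʳ Z))) (sym (*-distribˡ-+ Z (cum tree i d) 1)))))) ⟩
          fromℕ (cum tree i d + 1) ℚ.* half^ d
            ≡⟨ cong (ℚ._* half^ d) (fromℕ-+ (cum tree i d) 1) ⟩
          (fromℕ (cum tree i d) ℚ.+ ℚ.1ℚ) ℚ.* half^ d
            ≡⟨ ℚ.*-distribʳ-+ (half^ d) (fromℕ (cum tree i d)) ℚ.1ℚ ⟩
          fromℕ (cum tree i d) ℚ.* half^ d ℚ.+ ℚ.1ℚ ℚ.* half^ d
            ≡⟨ cong (fromℕ (cum tree i d) ℚ.* half^ d ℚ.+_) (ℚ.*-identityˡ (half^ d)) ⟩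
          fromℕ (cum tree i d) ℚ.* half^ d ℚ.+ half^ d ∎
          where open ℚ.≤-Reasoning

      -- Obtained as a complement from `cum+alive`, because the level sums above treat only weights
      -- that vanish on branch nodes.
      alive-tree : ∀ d → alive tree d ≡ width (2 ^ d % Z)
      alive-tree d = *-cancelˡ-≡ _ _ Z (+-cancelˡ-≡ (Z * S) _ _ (begin
        Z * S + Z * alive tree d                         ≡⟨ *-distribˡ-+ Z S (alive tree d) ⟨
        Z * (S + alive tree d)                           ≡⟨ cong (Z *_) (cum+alive tree d) ⟩
        Z * 2 ^ d                                        ≡⟨ *-comm Z (2 ^ d) ⟩
        2 ^ d * Z                                        ≡⟨ Σ-* (2 ^ d) M (allFin n) ⟨
        sumFin (λ i → 2 ^ d * M i)                       ≡⟨ Σ-cong (λ i → sym (cum-tree i d)) (allFin n) ⟩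
        sumFin (λ i → Z * cum tree i d + rest i d)       ≡⟨ Σ-+ (λ i → Z * cum tree i d) (λ i → rest i d) (allFin n) ⟩
        sumFin (λ i → Z * cum tree i d) + sumFin (λ i → rest i d) ≡⟨ cong₂ _+_ (Σ-* Z (λ i → cum tree i d) (allFin n)) (sym (Z*width (2 ^ d % Z))) ⟩
        Z * S + Z * width (2 ^ d % Z)                    ∎))
        where
        open ≡-Reasoning
        S = sumFin (λ i → cum tree i d)

      alive-tree≤Z : ∀ d → alive tree d ≤ Z
      alive-tree≤Z d = ≤-trans (≤-reflexive (alive-tree d))
        (≤-trans (width≤ (2 ^ d % Z)) (m%n≤n (2 ^ d) Z))

      -- Comparison of an arbitrary tree with the explicit one

      module _ {T : DDG n} (outT : HasOutput T (λ i → ratio (M i) Z)) where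

        -- `cum tree i d` is the integer part of 2 ^ d pᵢ, and `cum T i d` is an integer not
        -- exceeding 2 ^ d pᵢ.
        cum≤cum-tree : ∀ i d → cum T i d ≤ cum tree i d
        cum≤cum-tree i d = ≤-pred (*-cancelˡ-< Z _ _ (begin-strict
          Z * cum T i d                 ≤⟨ cum-bound M outT i d ⟩
          2 ^ d * M i                   ≡⟨ cum-tree i d ⟨
          Z * cum tree i d + rest i d   <⟨ +-monoʳ-< (Z * cum tree i d) (rest<Z i d) ⟩
          Z * cum tree i d + Z          ≡⟨ trans (+-comm _ Z) (sym (*-suc Z (cum tree i d))) ⟩
          Z * suc (cum tree i d)        ∎))
          where open ≤-Reasoning

        alive-tree≤alive : ∀ d → alive tree d ≤ alive T d
        alive-tree≤alive d = +-cancelˡ-≤ S (alive tree d) (alive T d) (begin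
          S + alive tree d                           ≤⟨ +-monoˡ-≤ (alive tree d) (Σ-mono (λ i → cum≤cum-tree i d) (allFin n)) ⟩
          sumFin (λ i → cum tree i d) + alive tree d ≡⟨ trans (cum+alive tree d) (sym (cum+alive T d)) ⟩
          S + alive T d                              ∎)
          where
          open ≤-Reasoning
          S = sumFin (λ i → cum T i d)

        module _ (alive≡ : ∀ d → alive T d ≡ alive tree d) where

          -- Equal branch counts leave equal totals for the halted strings, and totals of termwise
          -- ordered families agree only if all terms do.
          cum≡cum-tree : ∀ i d → cum T i d ≡ cum tree i d
          cum≡cum-tree i d = Σ-tight (λ k → cum≤cum-tree k d)
            (≤-reflexive (+-cancelʳ-≡ (alive tree d) _ _ (trans (cum+alive tree d)
              (trans (sym (cum+alive T d)) (cong (sumFin (λ k → cum T k d) +_) (alive≡ d))))))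
            (∈-allFin i)

          leaves≡digit : ∀ i d → leaves T i (suc d) ≡ digit i (suc d)
          leaves≡digit i d = trans (+-cancelˡ-≡ (2 * cum T i d) _ _
            (trans (cum≡cum-tree i (suc d)) (cong (λ a → 2 * a + leaves tree i (suc d)) (sym (cum≡cum-tree i d)))))
            (leaves-tree i d)

      -- By long division, `2 ^ k * rest i a - rest i (a + k)` is `Z` times the number written by
      -- the `k` digits after position `a`, and likewise for `b`. The form with sums avoids
      -- truncated subtraction.
      same-digits : ∀ i a b → (∀ k → digit i (a + suc k) ≡ digit i (b + suc k)) →
        ∀ k → 2 ^ k * rest i a + rest i (b + k) ≡ 2 ^ k * rest i b + rest i (a + k)
      same-digits i a b same zero rewrite +-identityʳ a | +-identityʳ b | +-identityʳ (rest i a) | +-identityʳ (rest i b) =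
        +-comm (rest i a) (rest i b)
      same-digits i a b same (suc k) = +-cancelʳ-≡ (Z * digit i (b + suc k)) _ _ (begin
        2 * 2 ^ k * ra + rest i (b + suc k) + Z * digit i (b + suc k)
          ≡⟨ double (2 ^ k) ra b ⟨
        2 * (2 ^ k * ra + rest i (b + k))
          ≡⟨ cong (2 *_) (same-digits i a b same k) ⟩
        2 * (2 ^ k * rb + rest i (a + k))
          ≡⟨ double (2 ^ k) rb a ⟩
        2 * 2 ^ k * rb + rest i (a + suc k) + Z * digit i (a + suc k)
          ≡⟨ cong (λ e → 2 * 2 ^ k * rb + rest i (a + suc k) + Z * e) (same k) ⟩
        2 * 2 ^ k * rb + rest i (a + suc k) + Z * digit i (b + suc k) ∎)
        where
        open ≡-Reasoning
        ra = rest i a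
        rb = rest i b
        double : ∀ t r b → 2 * (t * r + rest i (b + k)) ≡ 2 * t * r + rest i (b + suc k) + Z * digit i (b + suc k)
        double t r b rewrite +-suc b k = begin
          2 * (t * r + rest i (b + k))          ≡⟨ *-distribˡ-+ 2 (t * r) _ ⟩
          2 * (t * r) + 2 * rest i (b + k)      ≡⟨ cong₂ _+_ (sym (*-assoc 2 t r)) (double-rest i (b + k)) ⟩
          2 * t * r + (rest i (suc (b + k)) + Z * digit i (suc (b + k))) ≡⟨ +-assoc (2 * t * r) _ _ ⟨
          2 * t * r + rest i (suc (b + k)) + Z * digit i (suc (b + k)) ∎

      -- A smaller `rest i a` would fall behind by at least 1, hence by `2 ^ k` after `k` doublings,
      -- while remainders stay below `Z`. Taking `k = Z` suffices because `Z < 2 ^ Z`.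
      same-digits⇒≥ : ∀ i a b → (∀ k → digit i (a + suc k) ≡ digit i (b + suc k)) → rest i b ≤ rest i a
      same-digits⇒≥ i a b same = ≮⇒≥ λ ra<rb → <⇒≱ (<-trans (rest<Z i (b + Z)) (n<2^n Z))
        (+-cancelˡ-≤ (2 ^ Z * rest i a) (2 ^ Z) (rest i (b + Z)) (begin
          2 ^ Z * rest i a + 2 ^ Z                ≡⟨ trans (+-comm _ (2 ^ Z)) (sym (*-suc (2 ^ Z) (rest i a))) ⟩
          2 ^ Z * suc (rest i a)                  ≤⟨ *-monoʳ-≤ (2 ^ Z) ra<rb ⟩
          2 ^ Z * rest i b                        ≤⟨ m≤m+n _ (rest i (a + Z)) ⟩
          2 ^ Z * rest i b + rest i (a + Z)       ≡⟨ same-digits i a b same Z ⟨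
          2 ^ Z * rest i a + rest i (b + Z)       ∎))
        where open ≤-Reasoning

      -- Least period of the digits, and precision

      module _ (Z-prime : Prime Z) (primitive-root : PrimitiveRoot 2 Z) where

        private
          P : ℕ
          P = Z ∸ 1

        P>0 : 0 < P
        P>0 = m<n⇒0<n∸m 1<Z

        2^P%Z : 2 ^ P % Z ≡ 1
        2^P%Z = trans (cong (λ k → 2 ^ k % Z) (sym (totient-prime Z-prime)))
          (trans (PrimitiveRoot⇒^totient primitive-root) (m<n⇒m%n≡m 1<Z))

        alive-P : alive tree P ≡ 1
        alive-P = trans (alive-tree P) (trans (cong width 2^P%Z) width-1)

        -- Equal digits from `P + s` and from `P` on give equal remainders there, so `2 ^ s * M i`
        -- and `M i` agree modulo `Z`. As `Z` is prime and `0 < M i < Z`, the factor cancels, and 2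
        -- would have order less than `P`.
        digit-aperiodic : ∀ i s → 0 < s → s < P → ¬ (∀ k → digit i (P + suc (s + k)) ≡ digit i (P + suc k))
        digit-aperiodic i s 0<s s<P same =
          PrimitiveRoot⇒order primitive-root s 0<s (subst (s <_) (sym (totient-prime Z-prime)) s<P) 2^s%Z
          where
          shifted : ∀ k → digit i (P + s + suc k) ≡ digit i (P + suc k)
          shifted k = trans (cong (digit i) (trans (+-assoc P s (suc k)) (cong (P +_) (+-suc s k)))) (same k)

          rest-periodic : rest i (P + s) ≡ rest i P
          rest-periodic = ≤-antisym (same-digits⇒≥ i P (P + s) (sym ∘ shifted)) (same-digits⇒≥ i (P + s) P shifted)

          Z∣2^s*M∸M : Z ∣ 2 ^ s * M i ∸ M i
          Z∣2^s*M∸M = m%n≡o%n⇒n∣o∸m (M i) (2 ^ s * M i) Z (sym (begin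
            (2 ^ s * M i) % Z                     ≡⟨ [m%n*o]%n≡[m*o]%n (2 ^ s) (M i) Z ⟨
            (2 ^ s % Z * M i) % Z                 ≡⟨ cong (λ y → (y % Z * M i) % Z) (*-identityˡ (2 ^ s)) ⟨
            ((1 * 2 ^ s) % Z * M i) % Z           ≡⟨ cong (λ y → ((y * 2 ^ s) % Z * M i) % Z) 2^P%Z ⟨
            ((2 ^ P % Z * 2 ^ s) % Z * M i) % Z   ≡⟨ cong (λ y → (y * M i) % Z) ([m%n*o]%n≡[m*o]%n (2 ^ P) (2 ^ s) Z) ⟩
            ((2 ^ P * 2 ^ s) % Z * M i) % Z       ≡⟨ cong (λ y → (y % Z * M i) % Z) (^-distribˡ-+-* 2 P s) ⟨
            rest i (P + s)                        ≡⟨ rest-periodic ⟩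
            rest i P                              ≡⟨ cong (λ y → (y * M i) % Z) 2^P%Z ⟩
            (1 * M i) % Z                         ≡⟨ cong (_% Z) (*-identityˡ (M i)) ⟩
            M i % Z                               ∎))
            where open ≡-Reasoning

          2^s%Z : 2 ^ s % Z ≡ 1 % Z
          2^s%Z with euclidsLemma (2 ^ s ∸ 1) (M i) Z-prime
            (subst (Z ∣_) (trans (cong (2 ^ s * M i ∸_) (sym (*-identityˡ (M i)))) (sym (*-distribʳ-∸ (M i) (2 ^ s) 1))) Z∣2^s*M∸M)
          ... | inj₁ Z∣2^s∸1 = trans (cong (_% Z) (sym (m+[n∸m]≡n (m^n>0 2 s)))) (%-remove-+ʳ 1 Z∣2^s∸1)
          ... | inj₂ Z∣M = contradiction Z∣M (>⇒∤ {{>-nonZero (M>0 i)}} (M<Z i))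

        simplePath : ∀ {T} → HasOutput T (λ i → ratio (M i) Z) → (∀ d → alive T d ≡ alive tree d) →
          SimplePathToLeaf T P
        simplePath {T} outT alive≡ = simplePathToLeaf T (labelled i₀) P P>0 (trans (alive≡ P) alive-P)
          λ s 0<s s<P per → digit-aperiodic i₀ s 0<s s<P λ k →
            trans (sym (at (s + k))) (trans (per k) (at k))
          where
          at : ∀ k → leaves T i₀ (P + suc k) ≡ digit i₀ (P + suc k)
          at k = subst (λ d → leaves T i₀ d ≡ digit i₀ d) (sym (+-suc P k)) (leaves≡digit outT alive≡ i₀ (P + k))

        -- The bound on `m` is invariant: a branch node has index below `width x ≤ x < Z`, so its
        -- children have index at most `2 * Z`.
        walk-bound : ∀ {x m} → x < Z → m ≤ 2 * Z → ∀ bs {v} → walk tree (node x m) bs ≡ just v → v < Z + 2 * Z * Z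
        walk-bound x<Z m≤2Z [] refl = +-mono-<-≤ x<Z (*-monoˡ-≤ Z m≤2Z)
        walk-bound {x} {m} x<Z m≤2Z (b ∷ bs) {v} eq = go (c tree (node x m)) refl
          where
          go : ∀ l → c tree (node x m) ≡ l → v < Z + 2 * Z * Z
          go (leaf i) cv = contradiction (trans (sym eq) (walk-leaf tree cv b bs)) λ ()
          go branch cv = walk-bound {m = bit b + 2 * m} (m%n<n (2 * x) Z) index≤ bs
            (trans (cong (λ w → walk tree w bs) (sym (δ-node x<Z m b))) (trans (sym (walk-branch tree cv b bs)) eq))
            where
            m<Z : m < Z
            m<Z = <-trans (<-≤-trans (c-node-branch x<Z cv) (width≤ x)) x<Z
            index≤ : bit b + 2 * m ≤ 2 * Z
            index≤ = begin
              bit b + 2 * m    ≤⟨ +-monoˡ-≤ (2 * m) (≤-trans {bit b} {1} {2} (bit≤1 b) (s≤s z≤n)) ⟩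
              2 + 2 * m        ≡⟨ *-suc 2 m ⟨
              2 * suc m        ≤⟨ *-monoʳ-≤ 2 m<Z ⟩
              2 * Z            ∎
              where open ≤-Reasoning

        finiteNodes : FiniteNodes tree
        finiteNodes = Z + 2 * Z * Z , λ bs v → walk-bound {m = 0} 1<Z z≤n bs

        -- A halting walk with more than `j` bits cannot have reached a leaf after `j` of them, so
        -- it passes a branch node of that level, and branch nodes have index below the width.
        visited-level : ∀ j {x m} → x < Z → ∀ bs {i} → j < length bs → outFrom tree (node x m) bs ≡ just i →
          ∃[ m′ ] (m′ < width ((2 ^ j * x) % Z) × node ((2 ^ j * x) % Z) m′ ∈ visited tree (node x m) bs)
        visited-level j {x} {m} x<Z (b ∷ bs) {i} j<len eq = go (c tree (node x m)) refl
          where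
          go : ∀ l → c tree (node x m) ≡ l →
            ∃[ m′ ] (m′ < width ((2 ^ j * x) % Z) × node ((2 ^ j * x) % Z) m′ ∈ visited tree (node x m) (b ∷ bs))
          go (leaf _) cv = contradiction (trans (sym eq) (outFrom-leaf tree cv b bs)) λ ()
          go branch cv = descend j j<len
            where
            descend : ∀ j → j < suc (length bs) →
              ∃[ m′ ] (m′ < width ((2 ^ j * x) % Z) × node ((2 ^ j * x) % Z) m′ ∈ visited tree (node x m) (b ∷ bs))
            descend zero _ = m , subst (λ y → m < width y × node y m ∈ visited tree (node x m) (b ∷ bs))
              (trans (sym (m<n⇒m%n≡m x<Z)) (cong (_% Z) (sym (*-identityˡ x))))
              (c-node-branch x<Z cv , here refl)
            descend (suc j) (s≤s j<len) =
              let v≡ = δ-node x<Z m b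
                  m′ , m′<w , v∈ = visited-level j {m = bit b + 2 * m} (m%n<n (2 * x) Z) bs j<len
                    (trans (cong (λ w → outFrom tree w bs) (sym v≡)) (trans (sym (outFrom-branch tree cv b bs)) eq))
                  x≡ = trans ([m*[o%n]]%n≡[m*o]%n (2 ^ j) (2 * x) Z)
                         (cong (_% Z) (trans (sym (*-assoc (2 ^ j) 2 x)) (cong (_* x) (*-comm (2 ^ j) 2))))
              in m′ , subst (λ y → m′ < width y) x≡ m′<w ,
                 there (subst₂ (λ y w → node y m′ ∈ visited tree w bs) x≡ (sym v≡) v∈)

        -- The only branch node at depth Z ∸ 1 is the root.
        simplePath≤ : ∀ k → SimplePathToLeaf tree k → k ≤ P
        simplePath≤ k ([] , refl , _ , _) = z≤n
        simplePath≤ k (b ∷ bs , refl , (i , eq) , root-fresh ∷ _) = ≮⇒≥ λ P<k →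
          -- The walk is followed from the child of the root, at level `2 % Z`, for `P ∸ 1` further
          -- bits. The root is then found in the rest of the visited list, which contradicts
          -- `root-fresh`.
          let m′ , m′<w , v∈ = visited-level (P ∸ 1) {m = bit b + 0} (m%n<n 2 Z) bs
                (∸-monoˡ-< P<k P>0)
                (trans (cong (λ w → outFrom tree w bs) (sym (δ-node 1<Z 0 b))) (trans (sym (outFrom-branch tree c-root b bs)) eq))
              root∈ = subst (λ w → node 1 0 ∈ visited tree w bs) (sym (δ-node 1<Z 0 b))
                (subst₂ (λ y m → node y m ∈ visited tree (node (2 % Z) (bit b + 0)) bs) level≡1
                  (n<1⇒n≡0 (subst (m′ <_) (trans (cong width level≡1) width-1) m′<w)) v∈)
          in All.lookup root-fresh root∈ refl
          where
          level≡1 : (2 ^ (P ∸ 1) * (2 % Z)) % Z ≡ 1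
          level≡1 = begin
            (2 ^ (P ∸ 1) * (2 % Z)) % Z    ≡⟨ [m*[o%n]]%n≡[m*o]%n (2 ^ (P ∸ 1)) 2 Z ⟩
            (2 ^ (P ∸ 1) * 2) % Z          ≡⟨ cong (_% Z) (*-comm (2 ^ (P ∸ 1)) 2) ⟩
            2 ^ suc (P ∸ 1) % Z            ≡⟨ cong (λ k → 2 ^ k % Z) (m+[n∸m]≡n P>0) ⟩
            2 ^ P % Z                      ≡⟨ 2^P%Z ⟩
            1                              ∎
            where open ≡-Reasoning

        tree-optimal : EntropyOptimal tree (λ i → ratio (M i) Z)
        tree-optimal = leastAlive⇒optimal M tree-output (λ T′ outT′ → alive-tree≤alive outT′)

        tree-precision : UsesPrecision tree P
        tree-precision = finiteNodes , simplePath tree-output (λ _ → refl) , simplePath≤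

        optimal-precision≥ : ∀ T k → EntropyOptimal T (λ i → ratio (M i) Z) → UsesPrecision T k → P ≤ k
        optimal-precision≥ T k (outT , optimal) (_ , _ , longest) = longest P
          (simplePath outT (optimal⇒leastAlive M {T* = tree} outT (optimal tree tree-output) (alive-tree≤alive outT) alive-tree≤Z))

M<sumFin : (M : Fin n → ℕ) → 2 ≤ n → (∀ i → 0 < M i) → ∀ i → M i < sumFin M
M<sumFin M (s≤s (s≤s _)) M>0 zero =
  <-≤-trans (m<m+n (M zero) (M>0 (suc zero))) (Σ-∈₂ M (λ ()) (∈-allFin zero) (∈-allFin (suc zero)))
M<sumFin M (s≤s (s≤s _)) M>0 (suc i) =
  <-≤-trans (m<m+n (M (suc i)) (M>0 zero)) (Σ-∈₂ M (λ ()) (∈-allFin (suc i)) (∈-allFin zero))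

theorem3p6 : (n : ℕ) → 2 ≤ n → (M : Fin n → ℕ) → (∀ i → 0 < M i) →
    Prime (sumFin M) → PrimitiveRoot 2 (sumFin M) →
    (∃[ T ] (EntropyOptimal T (λ i → ratio (M i) (sumFin M)) × UsesPrecision T (sumFin M ∸ 1)))
    × (∀ (T : DDG n) k → EntropyOptimal T (λ i → ratio (M i) (sumFin M)) → UsesPrecision T k → sumFin M ∸ 1 ≤ k)
theorem3p6 (suc n) 2≤n M M>0 Z-prime primitive-root =
  -- Outcome `zero` serves both as the default label and as the outcome whose digits exclude short
  -- periods.
  (tree M zero , tree-optimal M zero odd M>0 M<Z Z-prime primitive-root , tree-precision M zero odd M>0 M<Z Z-prime primitive-root) ,
  optimal-precision≥ M zero odd M>0 M<Z Z-prime primitive-root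
  where
  instance
    Z≢0 : NonZero (sumFin M)
    Z≢0 = prime⇒nonZero Z-prime
  odd = coprime2⇒odd (PrimitiveRoot⇒coprime primitive-root)
  M<Z = M<sumFin M 2≤n M>0
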